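{- Let $n\ge 2$, $m=n-1$, and let $A\in\mathbb Z^{m\times n}$ be a matrix such that (i) the greatest common divisor of all $m\times m$ minors of $A$ is $1$, and (ii) $\{\boldsymbol x\in\mathbb R^n_{\ge 0}:A\boldsymbol x=\boldsymbol 0\}=\{\boldsymbol 0\}$. Let $\boldsymbol z=(z_1,\dots,z_n)\in\mathbb Z^n$ be a primitive integral generator of the kernel of $A$ (i.e. $\gcd(z_1,\dots,z_n)=1$ and $\ker A=\mathbb R\boldsymbol z$). Then $$\mathrm g_1(A)=\frac{z^+z^- }{z^++z^- }-1,$$ where $z^+=\max\{z_i:z_i>0\}$ and $z^-=\max\{|z_i|:z_i<0\}$.
   Context: For $\boldsymbol b\in\mathbb Z^m$ let $P(A,\boldsymbol b)=\{\boldsymbol x\in\mathbb R^n_{\ge 0}:A\boldsymbol x=\boldsymbol b\}$, and let $\mathcal F_1(A)=\{\boldsymbol b\in\mathbb Z^m:\#(P(A,\boldsymbol b)\cap\mathbb Z^n)\ge 1\}$. Let $C\subset\mathbb R^m$ be the convex cone generated by the columns of $A$ and $\boldsymbol v=A\boldsymbol 1$, where $\boldsymbol 1\in\mathbb Z^n$ is the all-ones vector. The diagonal ($1$-)Frobenius number of $A$ is $$\mathrm g_1(A)=\min\{t\in\mathbb R_{\ge 0}:\ \mathrm{int}(t\boldsymbol v+C)\cap\mathbb Z^m\subseteq\mathcal F_1(A)\},$$ where $\mathrm{int}$ denotes the interior.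
   Formalization: With g₁ a minimum over t ≥ 0 the formula fails when min(z⁺,z⁻)=1 (A=(1 1): g₁=0, formula −1/2); it is proved that the minimum over all real t equals z⁺z⁻/(z⁺+z⁻)−1 and that g₁(A)=max(0, z⁺z⁻/(z⁺+z⁻)−1). -}

module Defs where

open import Algebra.Bundles using (CommutativeMonoid)
open import Algebra.Bundles.Raw using (RawMonoid)
import Algebra.Definitions.RawMonoid as RawSum
import Algebra.Properties.CommutativeSemigroup as CommutativeSemigroup
open import Data.Fin.Base as Fin using (Fin; zero; suc; toℕ; punchIn)
open import Data.Integer.Base as ℤ using (ℤ; +_; 0ℤ; 1ℤ)
import Data.Integer.Divisibility as ℤ
open import Data.Nat.Base as ℕ using (ℕ; zero; suc)
import Data.Nat.Properties as ℕ
open import Data.Product.Base using (Σ-syntax; ∃-syntax; _×_; _,_; proj₁; proj₂)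
open import Data.Rational.Base as ℚ using (ℚ; 0ℚ; 1ℚ; ½)
import Data.Rational.Properties as ℚ
open import Data.Vec.Functional using (Vector; replicate)
open import Function.Base using (flip; _∘_)
open import Function.Bundles using (_⇔_)
open import Level using (Level; 0ℓ; _⊔_)
open import Relation.Binary.Core using (Rel)
open import Relation.Binary.PropositionalEquality using (_≡_; _≢_; sym; cong; cong₂; subst)
open import Relation.Nullary.Negation using (¬_)
open import Relation.Unary using (Pred)

private
  variable
    a ℓ ℓ₁ ℓ₂ : Level
    m n : ℕ

-- ℝ is the setoid of Cauchy sequences of rationals, each with its modulus;
-- equality and order only look at the tails of the sequences.

Eventually : Pred ℕ ℓ → Set ℓ
Eventually P = ∃[ N ] (∀ n → N ℕ.≤ n → P n)

IsCauchy : (ℕ → ℚ) → Set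
IsCauchy x = ∀ ε → 0ℚ ℚ.< ε → ∃[ N ] (∀ m n → N ℕ.≤ m → N ℕ.≤ n → ℚ.∣ x m ℚ.- x n ∣ ℚ.< ε)

record ℝ : Set where
  constructor mkℝ
  field
    seq    : ℕ → ℚ
    cauchy : IsCauchy seq

open ℝ public

infix 4 _≈_ _≤_ _<_

-- Records rather than plain functions, so that x and y can be inferred from
-- the type of a proof.

record _≈_ (x y : ℝ) : Set where
  constructor mk≈
  field
    close : ∀ ε → 0ℚ ℚ.< ε → Eventually λ k → ℚ.∣ seq x k ℚ.- seq y k ∣ ℚ.< ε

record _≤_ (x y : ℝ) : Set where
  constructor mk≤
  field
    below : ∀ ε → 0ℚ ℚ.< ε → Eventually λ k → seq x k ℚ.< seq y k ℚ.+ ε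

record _<_ (x y : ℝ) : Set where
  constructor mk<
  field
    gap       : ℚ
    gap-pos   : 0ℚ ℚ.< gap
    separated : Eventually λ k → seq x k ℚ.+ gap ℚ.< seq y k

fromℚ : ℚ → ℝ
fromℚ p = mkℝ (λ _ → p) λ ε 0<ε → 0 , λ _ _ _ _ → subst (ℚ._< ε) (cong ℚ.∣_∣ (sym (ℚ.+-inverseʳ p))) 0<ε

fromℤ : ℤ → ℝ
fromℤ i = fromℚ (i ℚ./ 1)

0ℝ : ℝ
0ℝ = fromℚ 0ℚ

module Cauchy where
  open ℚ.≤-Reasoning
  open CommutativeSemigroup (CommutativeMonoid.commutativeSemigroup ℚ.+-0-commutativeMonoid)

  half-pos : ∀ ε → 0ℚ ℚ.< ε → 0ℚ ℚ.< ½ ℚ.* ε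
  half-pos ε 0<ε = subst (ℚ._< ½ ℚ.* ε) (ℚ.*-zeroʳ ½) (ℚ.*-monoʳ-<-pos ½ 0<ε)

  halves : ∀ ε → ½ ℚ.* ε ℚ.+ ½ ℚ.* ε ≡ ε
  halves ε = begin-equality
    ½ ℚ.* ε ℚ.+ ½ ℚ.* ε  ≡⟨ ℚ.*-distribʳ-+ ε ½ ½ ⟨
    (½ ℚ.+ ½) ℚ.* ε      ≡⟨ ℚ.*-identityˡ ε ⟩
    ε                    ∎

  sum-diff : ∀ p q r s → (p ℚ.+ q) ℚ.- (r ℚ.+ s) ≡ (p ℚ.- r) ℚ.+ (q ℚ.- s)
  sum-diff p q r s = begin-equality
    (p ℚ.+ q) ℚ.- (r ℚ.+ s)            ≡⟨ cong (p ℚ.+ q ℚ.+_) (ℚ.neg-distrib-+ r s) ⟩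
    (p ℚ.+ q) ℚ.+ (ℚ.- r ℚ.+ ℚ.- s)    ≡⟨ interchange p q (ℚ.- r) (ℚ.- s) ⟩
    (p ℚ.- r) ℚ.+ (q ℚ.- s)            ∎

  split-at : ∀ p q → q ≡ p ℚ.+ (q ℚ.- p)
  split-at p q = begin-equality
    q                    ≡⟨ ℚ.+-identityʳ q ⟨
    q ℚ.+ 0ℚ             ≡⟨ cong (q ℚ.+_) (ℚ.+-inverseʳ p) ⟨
    q ℚ.+ (p ℚ.- p)      ≡⟨ x∙yz≈y∙xz q p (ℚ.- p) ⟩
    p ℚ.+ (q ℚ.- p)      ∎

  *-distribˡ-sub : ∀ p q r → p ℚ.* (q ℚ.- r) ≡ p ℚ.* q ℚ.- p ℚ.* r
  *-distribˡ-sub p q r = begin-equality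
    p ℚ.* (q ℚ.- r)              ≡⟨ ℚ.*-distribˡ-+ p q (ℚ.- r) ⟩
    p ℚ.* q ℚ.+ p ℚ.* (ℚ.- r)    ≡⟨ cong (p ℚ.* q ℚ.+_) (ℚ.neg-distribʳ-* p r) ⟨
    p ℚ.* q ℚ.- p ℚ.* r          ∎

  product-diff : ∀ p q r s → p ℚ.* q ℚ.- r ℚ.* s ≡ p ℚ.* (q ℚ.- s) ℚ.+ s ℚ.* (p ℚ.- r)
  product-diff p q r s = begin-equality
    p ℚ.* q ℚ.- r ℚ.* s
      ≡⟨ cong (ℚ._- r ℚ.* s) (split-at (p ℚ.* s) (p ℚ.* q)) ⟩
    p ℚ.* s ℚ.+ (p ℚ.* q ℚ.- p ℚ.* s) ℚ.- r ℚ.* s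
      ≡⟨ xy∙z≈y∙xz (p ℚ.* s) (p ℚ.* q ℚ.- p ℚ.* s) (ℚ.- (r ℚ.* s)) ⟩
    (p ℚ.* q ℚ.- p ℚ.* s) ℚ.+ (p ℚ.* s ℚ.- r ℚ.* s)
      ≡⟨ cong₂ ℚ._+_ (sym (*-distribˡ-sub p q s)) (cong₂ ℚ._-_ (ℚ.*-comm p s) (ℚ.*-comm r s)) ⟩
    p ℚ.* (q ℚ.- s) ℚ.+ (s ℚ.* p ℚ.- s ℚ.* r)
      ≡⟨ cong (p ℚ.* (q ℚ.- s) ℚ.+_) (*-distribˡ-sub s p r) ⟨
    p ℚ.* (q ℚ.- s) ℚ.+ s ℚ.* (p ℚ.- r) ∎

  ≤⊔ˡ : ∀ {M N k} → M ℕ.⊔ N ℕ.≤ k → M ℕ.≤ k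
  ≤⊔ˡ {M} {N} = ℕ.m⊔n≤o⇒m≤o M N

  ≤⊔ʳ : ∀ {M N k} → M ℕ.⊔ N ℕ.≤ k → N ℕ.≤ k
  ≤⊔ʳ {M} {N} = ℕ.m⊔n≤o⇒n≤o M N

  +-cauchy : ∀ x y → IsCauchy x → IsCauchy y → IsCauchy (λ k → x k ℚ.+ y k)
  +-cauchy x y cx cy ε 0<ε
    with M , p ← cx (½ ℚ.* ε) (half-pos ε 0<ε) | N , q ← cy (½ ℚ.* ε) (half-pos ε 0<ε)
    = M ℕ.⊔ N , λ i j ≤i ≤j → begin-strict
        ℚ.∣ (x i ℚ.+ y i) ℚ.- (x j ℚ.+ y j) ∣
          ≡⟨ cong ℚ.∣_∣ (sum-diff (x i) (y i) (x j) (y j)) ⟩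
        ℚ.∣ (x i ℚ.- x j) ℚ.+ (y i ℚ.- y j) ∣
          ≤⟨ ℚ.∣p+q∣≤∣p∣+∣q∣ (x i ℚ.- x j) (y i ℚ.- y j) ⟩
        ℚ.∣ x i ℚ.- x j ∣ ℚ.+ ℚ.∣ y i ℚ.- y j ∣
          <⟨ ℚ.+-mono-< (p i j (≤⊔ˡ {M} ≤i) (≤⊔ˡ {M} ≤j)) (q i j (≤⊔ʳ {M} ≤i) (≤⊔ʳ {M} ≤j)) ⟩
        ½ ℚ.* ε ℚ.+ ½ ℚ.* ε
          ≡⟨ halves ε ⟩
        ε ∎

  bounded : ∀ x → IsCauchy x → ∃[ B ] (ℚ.Positive B × Eventually λ k → ℚ.∣ x k ∣ ℚ.≤ B)
  bounded x cx with N , p ← cx 1ℚ (ℚ.positive⁻¹ 1ℚ)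
    = ℚ.∣ x N ∣ ℚ.+ 1ℚ
    , ℚ.nonNeg+pos⇒pos ℚ.∣ x N ∣ {{ℚ.∣-∣-nonNeg (x N)}} 1ℚ
    , N , λ k N≤k → begin
        ℚ.∣ x k ∣                        ≡⟨ cong ℚ.∣_∣ (split-at (x N) (x k)) ⟩
        ℚ.∣ x N ℚ.+ (x k ℚ.- x N) ∣      ≤⟨ ℚ.∣p+q∣≤∣p∣+∣q∣ (x N) (x k ℚ.- x N) ⟩
        ℚ.∣ x N ∣ ℚ.+ ℚ.∣ x k ℚ.- x N ∣  ≤⟨ ℚ.+-monoʳ-≤ ℚ.∣ x N ∣ (ℚ.<⇒≤ (p k N N≤k ℕ.≤-refl)) ⟩
        ℚ.∣ x N ∣ ℚ.+ 1ℚ                 ∎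

  product-bound : ∀ {B δ} p q → ℚ.Positive B → ℚ.∣ p ∣ ℚ.≤ B → ℚ.∣ q ∣ ℚ.< δ → ℚ.∣ p ℚ.* q ∣ ℚ.< B ℚ.* δ
  product-bound {B} {δ} p q B>0 p≤B q<δ = begin-strict
    ℚ.∣ p ℚ.* q ∣        ≡⟨ ℚ.∣p*q∣≡∣p∣*∣q∣ p q ⟩
    ℚ.∣ p ∣ ℚ.* ℚ.∣ q ∣  ≤⟨ ℚ.*-monoʳ-≤-nonNeg ℚ.∣ q ∣ {{ℚ.∣-∣-nonNeg q}} p≤B ⟩
    B ℚ.* ℚ.∣ q ∣        <⟨ ℚ.*-monoʳ-<-pos B {{B>0}} q<δ ⟩
    B ℚ.* δ              ∎

  *-cauchy : ∀ x y → IsCauchy x → IsCauchy y → IsCauchy (λ k → x k ℚ.* y k)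
  *-cauchy x y cx cy ε 0<ε = go (cx δ 0<δ) (cy δ 0<δ)
    where
    B D : ℚ
    B = proj₁ (bounded x cx)
    D = proj₁ (bounded y cy)
    B>0 : ℚ.Positive B
    B>0 = proj₁ (proj₂ (bounded x cx))
    D>0 : ℚ.Positive D
    D>0 = proj₁ (proj₂ (bounded y cy))
    M N : ℕ
    M = proj₁ (proj₂ (proj₂ (bounded x cx)))
    N = proj₁ (proj₂ (proj₂ (bounded y cy)))
    p : ∀ k → M ℕ.≤ k → ℚ.∣ x k ∣ ℚ.≤ B
    p = proj₂ (proj₂ (proj₂ (bounded x cx)))
    q : ∀ k → N ℕ.≤ k → ℚ.∣ y k ∣ ℚ.≤ D
    q = proj₂ (proj₂ (proj₂ (bounded y cy)))
    instance
      S>0 : ℚ.Positive (B ℚ.+ D)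
      S>0 = ℚ.pos+pos⇒pos B {{B>0}} D {{D>0}}
      S≢0 : ℚ.NonZero (B ℚ.+ D)
      S≢0 = ℚ.pos⇒nonZero (B ℚ.+ D)
      1/S>0 : ℚ.Positive (ℚ.1/ (B ℚ.+ D))
      1/S>0 = ℚ.1/pos⇒pos (B ℚ.+ D)
    δ : ℚ
    δ = ℚ.1/ (B ℚ.+ D) ℚ.* ε
    0<δ : 0ℚ ℚ.< δ
    0<δ = subst (ℚ._< δ) (ℚ.*-zeroʳ (ℚ.1/ (B ℚ.+ D))) (ℚ.*-monoʳ-<-pos (ℚ.1/ (B ℚ.+ D)) 0<ε)
    go : ∃[ K ] (∀ i j → K ℕ.≤ i → K ℕ.≤ j → ℚ.∣ x i ℚ.- x j ∣ ℚ.< δ) →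
         ∃[ L ] (∀ i j → L ℕ.≤ i → L ℕ.≤ j → ℚ.∣ y i ℚ.- y j ∣ ℚ.< δ) →
         ∃[ R ] (∀ i j → R ℕ.≤ i → R ℕ.≤ j → ℚ.∣ x i ℚ.* y i ℚ.- x j ℚ.* y j ∣ ℚ.< ε)
    go (K , r) (L , s) = (M ℕ.⊔ N) ℕ.⊔ (K ℕ.⊔ L) , λ i j ≤i ≤j → begin-strict
      ℚ.∣ x i ℚ.* y i ℚ.- x j ℚ.* y j ∣
        ≡⟨ cong ℚ.∣_∣ (product-diff (x i) (y i) (x j) (y j)) ⟩
      ℚ.∣ x i ℚ.* (y i ℚ.- y j) ℚ.+ y j ℚ.* (x i ℚ.- x j) ∣
        ≤⟨ ℚ.∣p+q∣≤∣p∣+∣q∣ (x i ℚ.* (y i ℚ.- y j)) (y j ℚ.* (x i ℚ.- x j)) ⟩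
      ℚ.∣ x i ℚ.* (y i ℚ.- y j) ∣ ℚ.+ ℚ.∣ y j ℚ.* (x i ℚ.- x j) ∣
        <⟨ ℚ.+-mono-<
             (product-bound (x i) (y i ℚ.- y j) B>0 (p i (≤⊔ˡ {M} (≤⊔ˡ {M ℕ.⊔ N} ≤i)))
               (s i j (≤⊔ʳ {K} (≤⊔ʳ {M ℕ.⊔ N} ≤i)) (≤⊔ʳ {K} (≤⊔ʳ {M ℕ.⊔ N} ≤j))))
             (product-bound (y j) (x i ℚ.- x j) D>0 (q j (≤⊔ʳ {M} (≤⊔ˡ {M ℕ.⊔ N} ≤j)))
               (r i j (≤⊔ˡ {K} (≤⊔ʳ {M ℕ.⊔ N} ≤i)) (≤⊔ˡ {K} (≤⊔ʳ {M ℕ.⊔ N} ≤j)))) ⟩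
      B ℚ.* δ ℚ.+ D ℚ.* δ
        ≡⟨ ℚ.*-distribʳ-+ δ B D ⟨
      (B ℚ.+ D) ℚ.* (ℚ.1/ (B ℚ.+ D) ℚ.* ε)
        ≡⟨ ℚ.*-assoc (B ℚ.+ D) (ℚ.1/ (B ℚ.+ D)) ε ⟨
      (B ℚ.+ D) ℚ.* ℚ.1/ (B ℚ.+ D) ℚ.* ε
        ≡⟨ cong (ℚ._* ε) (ℚ.*-inverseʳ (B ℚ.+ D)) ⟩
      1ℚ ℚ.* ε
        ≡⟨ ℚ.*-identityˡ ε ⟩
      ε ∎

infixl 6 _+_
infixl 7 _*_

_+_ : ℝ → ℝ → ℝ
x + y = mkℝ (λ k → seq x k ℚ.+ seq y k) (Cauchy.+-cauchy (seq x) (seq y) (cauchy x) (cauchy y))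

_*_ : ℝ → ℝ → ℝ
x * y = mkℝ (λ k → seq x k ℚ.* seq y k) (Cauchy.*-cauchy (seq x) (seq y) (cauchy x) (cauchy y))

+-0-rawMonoid : RawMonoid 0ℓ 0ℓ
+-0-rawMonoid = record { _≈_ = _≈_ ; _∙_ = _+_ ; ε = 0ℝ }

sumℝ : Vector ℝ n → ℝ
sumℝ = RawSum.sum +-0-rawMonoid

sumℤ : Vector ℤ n → ℤ
sumℤ = RawSum.sum ℤ.+-0-rawMonoid

infix 4 _≈ⱽ_

_≈ⱽ_ : Rel (Vector ℝ n) 0ℓ
x ≈ⱽ y = ∀ i → x i ≈ y i

fromℤⱽ : Vector ℤ n → Vector ℝ n
fromℤⱽ x = fromℤ ∘ x

IsMinimum : {A : Set a} → Rel A ℓ₁ → Pred A ℓ₂ → A → Set (a ⊔ ℓ₁ ⊔ ℓ₂)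
IsMinimum _≼_ P x = P x × (∀ y → P y → x ≼ y)

IsMaximum : {A : Set a} → Rel A ℓ₁ → Pred A ℓ₂ → A → Set (a ⊔ ℓ₁ ⊔ ℓ₂)
IsMaximum _≼_ = IsMinimum (flip _≼_)

IsGCD : {I : Set} → (I → ℤ) → ℤ → Set
IsGCD f g = (∀ i → g ℤ.∣ f i) × (∀ d → (∀ i → d ℤ.∣ f i) → d ℤ.∣ g)

Matrix : ℕ → ℕ → Set
Matrix m n = Fin m → Fin n → ℤ

det : Matrix n n → ℤ
det {zero}  M = 1ℤ
det {suc n} M = sumℤ λ j →
  (ℤ.- 1ℤ) ℤ.^ toℕ j ℤ.* M zero j ℤ.* det (λ i k → M (suc i) (punchIn j k))

-- The m-element subsets of the n columns, each listed in increasing order.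
ColumnChoice : ℕ → ℕ → Set
ColumnChoice m n = Σ[ c ∈ (Fin m → Fin n) ] (∀ i j → i Fin.< j → c i Fin.< c j)

maximalMinor : Matrix m n → ColumnChoice m n → ℤ
maximalMinor A (c , _) = det λ i j → A i (c j)

infixr 8 _·ℤ_ _·_

_·ℤ_ : Matrix m n → Vector ℤ n → Vector ℤ m
(A ·ℤ x) i = sumℤ λ j → A i j ℤ.* x j

_·_ : Matrix m n → Vector ℝ n → Vector ℝ m
(A · x) i = sumℝ λ j → fromℤ (A i j) * x j

P : Matrix m n → Vector ℤ m → Pred (Vector ℝ n) 0ℓ
P A b x = (∀ j → 0ℝ ≤ x j) × A · x ≈ⱽ fromℤⱽ b

HasAtLeast : ℕ → Pred (Vector ℤ n) ℓ → Set ℓ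
HasAtLeast {n = n} k Q =
  Σ[ f ∈ (Fin k → Vector ℤ n) ] ((∀ i → Q (f i)) × (∀ i j → i ≢ j → ¬ (∀ l → f i l ≡ f j l)))

𝓕 : ℕ → Matrix m n → Pred (Vector ℤ m) 0ℓ
𝓕 k A b = HasAtLeast k λ x → P A b (fromℤⱽ x)

cone : Matrix m n → Pred (Vector ℝ m) 0ℓ
cone {n = n} A y =
  Σ[ c ∈ Vector ℝ n ] ((∀ j → 0ℝ ≤ c j) × (∀ i → y i ≈ sumℝ λ j → c j * fromℤ (A i j)))

-- The set t v + C with v = A 1.
shiftedCone : Matrix m n → ℝ → Pred (Vector ℝ m) 0ℓ
shiftedCone {m = m} A t y =
  Σ[ c ∈ Vector ℝ m ] (cone A c × (∀ i → y i ≈ t * fromℤ ((A ·ℤ replicate _ 1ℤ) i) + c i))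

-- Interior for the usual topology of ℝᵐ, with open sup-norm balls
-- |y i - x i| < ε as basic neighbourhoods.
interior : Pred (Vector ℝ m) 0ℓ → Pred (Vector ℝ m) 0ℓ
interior S x =
  ∃[ ε ] (0ℝ < ε × (∀ y → (∀ i → x i < y i + ε × y i < x i + ε) → S y))

Admissible : Matrix m n → Pred ℝ 0ℓ
Admissible A t = ∀ b → interior (shiftedCone A t) (fromℤⱽ b) → 𝓕 1 A b

IsDiagonalFrobenius : Matrix m n → ℝ → Set
IsDiagonalFrobenius A = IsMinimum _≤_ (λ t → 0ℝ ≤ t × Admissible A t)

-- The same minimum over all real t.  Negative t matter: for A = (1 1) and
-- z = (1 , -1) it is -1/2, whereas the minimum over t ≥ 0 is 0.
IsSignedDiagonalFrobenius : Matrix m n → ℝ → Set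
IsSignedDiagonalFrobenius A = IsMinimum _≤_ (Admissible A)

IsPrimitiveKernelGenerator : Matrix m n → Vector ℤ n → Set
IsPrimitiveKernelGenerator A z =
  IsGCD z 1ℤ ×
  (∀ x → A · x ≈ⱽ replicate _ 0ℝ ⇔ (∃[ r ] x ≈ⱽ λ j → r * fromℤ (z j)))

IsMaxPositive : Vector ℤ n → ℕ → Set
IsMaxPositive z = IsMaximum ℕ._≤_ λ k → ∃[ i ] (0ℤ ℤ.< z i × z i ≡ + k)

IsMaxAbsNegative : Vector ℤ n → ℕ → Set
IsMaxAbsNegative z = IsMaximum ℕ._≤_ λ k → ∃[ i ] (z i ℤ.< 0ℤ × ℤ.∣ z i ∣ ≡ k)

frobeniusValue : (z⁺ z⁻ : ℕ) → .{{ℕ.NonZero (z⁺ ℕ.+ z⁻)}} → ℚ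
frobeniusValue z⁺ z⁻ = + (z⁺ ℕ.* z⁻) ℚ./ (z⁺ ℕ.+ z⁻) ℚ.- 1ℚ

{-# OPTIONS --safe #-}
module Submission where

-- Since the maximal minors of A have greatest common divisor 1, Cramer's rule and Bézout's identity make
-- A ℤⁿ = ℤᵐ, so b ∈ int (t v + C) holds exactly if b = A x for an integral x with x + r z > t for some real r.
-- Because z is primitive, the integral solutions are the x + k z.  If t is at least the Frobenius value,
-- a k with - z⁺ / (z⁺ + z⁻) ≤ r - k ≤ z⁻ / (z⁺ + z⁻) changes every entry by at most z⁺ z⁻ / (z⁺ + z⁻), so
-- x + k z > -1.  Conversely an integral x with entry -1 where z is maximal and z⁻ - 1 where z is minimal
-- admits no nonnegative x + k z, although at r = z⁻ / (z⁺ + z⁻) both entries are the Frobenius value.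

open import Defs as ℝ hiding (_+_; _*_; _≤_; _<_)
open import Algebra.Bundles using (CommutativeRing; Semiring)
open import Data.Fin.Base using (Fin; zero; suc; toℕ; punchIn; finToFun; funToFin)
open import Data.Fin.Properties using (_≟_; any?; suc-injective; punchInᵢ≢i; finToFun-funToFin)
open import Data.Integer.Base as ℤ using (ℤ; +_; -[1+_]; 0ℤ; 1ℤ)
import Data.Integer.Divisibility as ℤ
import Data.Integer.DivMod as ℤ
import Data.Integer.Properties as ℤ
open import Data.Integer.Tactic.RingSolver using (solve-∀)
open import Data.Nat.Base as ℕ using (ℕ; zero; suc; _∸_; NonZero)
open import Data.Nat.Coprimality as ℕ using (1-coprimeTo)
open import Data.Nat.Divisibility using (∣-trans; ∣-refl; ∣1⇒≡1; 0∣⇒≡0)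
open import Data.Nat.GCD using (gcd; gcd-GCD; gcd[m,n]∣m; gcd[m,n]∣n; module Bézout)
import Data.Nat.Properties as ℕ
open import Data.Product.Base using (Σ-syntax; ∃-syntax; _×_; _,_; proj₁; proj₂)
open import Data.Rational.Base as ℚ using (ℚ; mkℚ; 0ℚ; 1ℚ; ½)
import Data.Rational.Properties as ℚ
open import Data.Rational.Solver using (module +-*-Solver)
import Data.Rational.Unnormalised.Base as ℚᵘ
import Data.Rational.Unnormalised.Properties as ℚᵘ
open import Data.Sum.Base using (_⊎_; inj₁; inj₂; [_,_]′)
open import Data.Unit.Base using (⊤)
open import Data.Vec.Functional using (Vector; updateAt; replicate)
open import Data.Vec.Functional.Properties using (updateAt-updates; updateAt-minimal; updateAt-id-local)
open import Function.Base using (const; id; _∘_)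
open import Function.Bundles using (_⇔_; module Equivalence)
open import Relation.Binary.PropositionalEquality using (_≡_; _≢_; _≗_; refl; sym; trans; cong; cong₂; cong-app; subst; subst₂)
open import Relation.Binary.PropositionalEquality using (module ≡-Reasoning)
open import Relation.Nullary using (Dec; yes; no; ¬_; contradiction)

-- Order and equality on ℝ are undecidable, so no case distinction is ever made on a real number.
-- The real coefficients (the kernel coefficient `r`, the cone coefficients `c`) are read off at one
-- late index of their Cauchy sequences, after which every inequality is rational; the slack `δ`
-- that the interior provides pays for the errors. Hence admissibility is proved for rational `t`,
-- while minimality, which concerns every real `t`, assumes only that `t` is eventually below some
-- rational `s`.
--
-- The fractions in the rounding step are forced: on `- z⁺ / (z⁺ + z⁻) ≤ d ≤ z⁻ / (z⁺ + z⁻)`, an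
-- interval of length 1, both extreme products `d * z j` equal `z⁺ z⁻ / (z⁺ + z⁻)`.
--
-- The formula is negative exactly when `z⁺` or `z⁻` is 1. It is therefore proved as the minimum
-- over all real `t`, and the minimum over `t ≥ 0` is its maximum with 0.

private
  variable
    l m n : ℕ
    i j : ℤ
    p q s t : ℚ

-- Finite sums over a semiring

module SemiringSum {c ℓ} (R : Semiring c ℓ) where
  open Semiring R using (Carrier; 0#; setoid) renaming (_≈_ to _≃_; _+_ to _⊕_; _*_ to _⊗_)
  open Semiring R using (+-congˡ; +-identityʳ; *-assoc) renaming (sym to ≈-sym)
  open import Algebra.Properties.Semiring.Sum R public
  open import Relation.Binary.Reasoning.Setoid setoid

  sum-single : (f : Vector Carrier n) (k : Fin n) → (∀ i → i ≢ k → f i ≃ 0#) → sum f ≃ f k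
  sum-single {suc n} f k off = begin
    sum f                     ≈⟨ sum-remove {i = k} f ⟩
    f k ⊕ sum (f ∘ punchIn k) ≈⟨ +-congˡ (sum-cong-≋ λ i → off (punchIn k i) (punchInᵢ≢i k i)) ⟩
    f k ⊕ sum {n} (λ _ → 0#)  ≈⟨ +-congˡ (sum-replicate-zero n) ⟩
    f k ⊕ 0#                  ≈⟨ +-identityʳ (f k) ⟩
    f k                       ∎

  -- Used over ℤ for Cramer's rule and over ℚ to apply `A` to a right inverse.
  sum-product-assoc : (a : Vector Carrier n) (B : Fin n → Fin l → Carrier) (c : Vector Carrier l) →
                      sum (λ j → a j ⊗ sum (λ k → B j k ⊗ c k)) ≃ sum (λ k → sum (λ j → a j ⊗ B j k) ⊗ c k)
  sum-product-assoc a B c = begin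
    sum (λ j → a j ⊗ sum (λ k → B j k ⊗ c k))
      ≈⟨ sum-cong-≋ (λ j → *-distribˡ-sum (a j) (λ k → B j k ⊗ c k)) ⟩
    sum (λ j → sum (λ k → a j ⊗ (B j k ⊗ c k)))
      ≈⟨ ∑-comm (λ j k → a j ⊗ (B j k ⊗ c k)) ⟩
    sum (λ k → sum (λ j → a j ⊗ (B j k ⊗ c k)))
      ≈⟨ sum-cong-≋ (λ k → sum-cong-≋ λ j → ≈-sym (*-assoc (a j) (B j k) (c k))) ⟩
    sum (λ k → sum (λ j → a j ⊗ B j k ⊗ c k))
      ≈⟨ sum-cong-≋ (λ k → *-distribʳ-sum (c k) (λ j → a j ⊗ B j k)) ⟨
    sum (λ k → sum (λ j → a j ⊗ B j k) ⊗ c k) ∎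

-- Determinants and integral solvability

module _ where
  open import Data.Integer.Base using (_+_; _*_; -_; _^_)

  module Σℤ = SemiringSum ℤ.+-*-semiring

  sum-cong₂ : (f g : Fin m → Fin n → ℤ) → (∀ i j → f i j ≡ g i j) →
              sumℤ (λ i → sumℤ (f i)) ≡ sumℤ (λ i → sumℤ (g i))
  sum-cong₂ f g f≡g = Σℤ.sum-cong-≗ λ i → Σℤ.sum-cong-≗ (f≡g i)

  unit : Fin n → Vector ℤ n
  unit k j with k ≟ j
  ... | yes _ = 1ℤ
  ... | no  _ = 0ℤ

  unit-diagonal : (j : Fin n) → unit j j ≡ 1ℤ
  unit-diagonal j with j ≟ j
  ... | yes _   = refl
  ... | no  j≢j = contradiction refl j≢j

  unit-off-diagonal : {k j : Fin n} → k ≢ j → unit k j ≡ 0ℤ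
  unit-off-diagonal {k = k} {j} k≢j with k ≟ j
  ... | yes k≡j = contradiction k≡j k≢j
  ... | no  _   = refl

  sum-unit : (w : Vector ℤ n) (j : Fin n) → sumℤ (λ k → w k * unit k j) ≡ w j
  sum-unit w j = begin
    sumℤ (λ k → w k * unit k j)  ≡⟨ Σℤ.sum-single (λ k → w k * unit k j) j off ⟩
    w j * unit j j               ≡⟨ cong (w j *_) (unit-diagonal j) ⟩
    w j * 1ℤ                     ≡⟨ ℤ.*-identityʳ (w j) ⟩
    w j                          ∎
    where
    open ≡-Reasoning
    off : ∀ k → k ≢ j → w k * unit k j ≡ 0ℤ
    off k k≢j = trans (cong (w k *_) (unit-off-diagonal k≢j)) (ℤ.*-zeroʳ (w k))

  sign : Fin n → ℤ
  sign j = (- 1ℤ) ^ toℕ j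

  minor : Matrix (suc n) (suc n) → Fin (suc n) → Matrix n n
  minor M j i k = M (suc i) (punchIn j k)

  det-cong : {M N : Matrix n n} → (∀ i j → M i j ≡ N i j) → det M ≡ det N
  det-cong {zero}  M≡N = refl
  det-cong {suc n} M≡N = Σℤ.sum-cong-≗ λ j →
    cong₂ _*_ (cong (sign j *_) (M≡N zero j)) (det-cong λ i k → M≡N (suc i) (punchIn j k))

  -- Expansion along the first row: if `r` is that row, the minors agree and the coefficients are
  -- linear; otherwise linearity is inherited from the minors. The matrices are described entrywise
  -- rather than by `updateAt`, so that the hypotheses restrict to minors directly.
  det-linear : (r : Fin n) (w : Vector ℤ l) (L : Matrix n n) (M : Fin l → Matrix n n) →
               (∀ j → L r j ≡ sumℤ (λ k → w k * M k r j)) →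
               (∀ k i → i ≢ r → ∀ j → L i j ≡ M k i j) →
               det L ≡ sumℤ (λ k → w k * det (M k))
  det-linear {suc n} zero w L M Lr off = begin
    sumℤ (λ j → sign j * L zero j * det (minor L j))
      ≡⟨ Σℤ.sum-cong-≗ (λ j → cong (λ x → sign j * x * det (minor L j)) (Lr j)) ⟩
    sumℤ (λ j → sign j * sumℤ (λ k → w k * M k zero j) * det (minor L j))
      ≡⟨ Σℤ.sum-cong-≗ (λ j → cong (_* det (minor L j)) (Σℤ.*-distribˡ-sum (sign j) (λ k → w k * M k zero j))) ⟩
    sumℤ (λ j → sumℤ (λ k → sign j * (w k * M k zero j)) * det (minor L j))
      ≡⟨ Σℤ.sum-cong-≗ (λ j → Σℤ.*-distribʳ-sum (det (minor L j)) (λ k → sign j * (w k * M k zero j))) ⟩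
    sumℤ (λ j → sumℤ (λ k → sign j * (w k * M k zero j) * det (minor L j)))
      ≡⟨ sum-cong₂ _ _ (λ j k → trans (reassoc (sign j) (w k) (M k zero j) (det (minor L j)))
           (cong (λ x → w k * (sign j * M k zero j * x)) (det-cong λ i l → off k (suc i) (λ ()) (punchIn j l)))) ⟩
    sumℤ (λ j → sumℤ (λ k → w k * (sign j * M k zero j * det (minor (M k) j))))
      ≡⟨ Σℤ.∑-comm (λ j k → w k * (sign j * M k zero j * det (minor (M k) j))) ⟩
    sumℤ (λ k → sumℤ (λ j → w k * (sign j * M k zero j * det (minor (M k) j))))
      ≡⟨ Σℤ.sum-cong-≗ (λ k → Σℤ.*-distribˡ-sum (w k) (λ j → sign j * M k zero j * det (minor (M k) j))) ⟨
    sumℤ (λ k → w k * det (M k)) ∎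
    where
    open ≡-Reasoning
    reassoc : ∀ s w x d → s * (w * x) * d ≡ w * (s * x * d)
    reassoc = solve-∀
  det-linear {suc n} (suc r) w L M Lr off = begin
    sumℤ (λ j → sign j * L zero j * det (minor L j))
      ≡⟨ Σℤ.sum-cong-≗ (λ j → cong (sign j * L zero j *_) (det-linear r w (minor L j) (λ k → minor (M k) j)
           (λ l → Lr (punchIn j l)) (λ k i i≢r l → off k (suc i) (i≢r ∘ suc-injective) (punchIn j l)))) ⟩
    sumℤ (λ j → sign j * L zero j * sumℤ (λ k → w k * det (minor (M k) j)))
      ≡⟨ Σℤ.sum-cong-≗ (λ j → Σℤ.*-distribˡ-sum (sign j * L zero j) (λ k → w k * det (minor (M k) j))) ⟩
    sumℤ (λ j → sumℤ (λ k → sign j * L zero j * (w k * det (minor (M k) j))))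
      ≡⟨ sum-cong₂ _ _ (λ j k → trans (reassoc (sign j) (w k) (L zero j) (det (minor (M k) j)))
           (cong (λ x → w k * (sign j * x * det (minor (M k) j))) (off k zero (λ ()) j))) ⟩
    sumℤ (λ j → sumℤ (λ k → w k * (sign j * M k zero j * det (minor (M k) j))))
      ≡⟨ Σℤ.∑-comm (λ j k → w k * (sign j * M k zero j * det (minor (M k) j))) ⟩
    sumℤ (λ k → sumℤ (λ j → w k * (sign j * M k zero j * det (minor (M k) j))))
      ≡⟨ Σℤ.sum-cong-≗ (λ k → Σℤ.*-distribˡ-sum (w k) (λ j → sign j * M k zero j * det (minor (M k) j))) ⟨
    sumℤ (λ k → w k * det (M k)) ∎
    where
    open ≡-Reasoning
    reassoc : ∀ s w x d → s * x * (w * d) ≡ w * (s * x * d)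
    reassoc = solve-∀

  det-additive : (r : Fin n) (L M N : Matrix n n) →
                 (∀ j → L r j ≡ M r j + N r j) →
                 (∀ i → i ≢ r → ∀ j → L i j ≡ M i j) → (∀ i → i ≢ r → ∀ j → L i j ≡ N i j) →
                 det L ≡ det M + det N
  det-additive {n} r L M N Lr offM offN = trans
    (det-linear r (const 1ℤ) L pick (λ j → trans (Lr j) (ones (M r j) (N r j))) off)
    (sym (ones (det M) (det N)))
    where
    pick : Fin 2 → Matrix n n
    pick zero    = M
    pick (suc _) = N
    off : ∀ k i → i ≢ r → ∀ j → L i j ≡ pick k i j
    off zero    = offM
    off (suc _) = offN
    ones : ∀ x y → x + y ≡ 1ℤ * x + (1ℤ * y + 0ℤ)
    ones = solve-∀

  -- G (j , l) depends only on the unordered pair {j , punchIn j l}.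
  Unordered : (Fin (suc n) → Fin n → ℤ) → Set
  Unordered {zero}  G = ⊤
  Unordered {suc n} G = (∀ l → G zero l ≡ G (suc l) zero) × Unordered (λ j l → G (suc j) (suc l))

  -- Deleting two columns leaves the same increasing list of columns in either order. If both
  -- indices are successors, the composite of the `punchIn`s fixes `zero`, and `lift` removes that
  -- point for the induction. Such maps agree only pointwise, whence the congruence hypothesis on
  -- `H`.
  unordered-pairs : (H : (Fin n → Fin (suc (suc n))) → ℤ) → (∀ {c d} → c ≗ d → H c ≡ H d) →
                    (G : Fin (suc (suc n)) → Fin (suc n) → ℤ) →
                    (∀ j l → G j l ≡ H (punchIn j ∘ punchIn l)) → Unordered G
  unordered-pairs {zero}  H H-cong G G≡H = (λ l → trans (G≡H zero l) (trans (H-cong λ ()) (sym (G≡H (suc l) zero)))) , _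
  unordered-pairs {suc n} H H-cong G G≡H =
    (λ l → trans (G≡H zero l) (trans (H-cong λ _ → refl) (sym (G≡H (suc l) zero)))) ,
    unordered-pairs (H ∘ lift) (λ c≗d → H-cong (lift-cong c≗d)) (λ j l → G (suc j) (suc l))
      (λ j l → trans (G≡H (suc j) (suc l)) (H-cong λ { zero → refl ; (suc k) → refl }))
    where
    lift : (Fin n → Fin (suc (suc n))) → Fin (suc n) → Fin (suc (suc (suc n)))
    lift c zero    = zero
    lift c (suc k) = suc (c k)
    lift-cong : ∀ {c d} → c ≗ d → lift c ≗ lift d
    lift-cong c≗d zero    = refl
    lift-cong c≗d (suc k) = cong suc (c≗d k)

  -- The terms of (j , k) and (k , j) cancel; those with j or k zero are split off first.
  alternating-sum : (a : Vector ℤ (suc n)) (G : Fin (suc n) → Fin n → ℤ) → Unordered G →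
                    sumℤ (λ j → sign j * a j * sumℤ (λ l → sign l * a (punchIn j l) * G j l)) ≡ 0ℤ
  alternating-sum {zero}  a G _ = collapse (a zero)
    where
    collapse : ∀ x → 1ℤ * x * 0ℤ + 0ℤ ≡ 0ℤ
    collapse = solve-∀
  alternating-sum {suc n} a G (G-sym , G-rest) = begin
    1ℤ * a₀ * X + sumℤ (λ j → sign (suc j) * a′ j * (1ℤ * a₀ * G (suc j) zero + sumℤ (λ l → sign (suc l) * a′ (punchIn j l) * G′ j l)))
      -- Passing to `suc j` and to `suc l` each flips a sign: both flips cancel in the recursive
      -- part, while the terms with inner index zero keep one and so oppose the terms with `j` zero.
      ≡⟨ cong (λ y → 1ℤ * a₀ * X + y) (Σℤ.sum-cong-≗ λ j → trans
           (cong (λ x → sign (suc j) * a′ j * (1ℤ * a₀ * G (suc j) zero + x)) (negate-inner j))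
           (split (sign j) (a′ j) a₀ (G (suc j) zero) (U j))) ⟩
    1ℤ * a₀ * X + sumℤ (λ j → - a₀ * (sign j * a′ j * G (suc j) zero) + sign j * a′ j * U j)
      ≡⟨ cong (λ y → 1ℤ * a₀ * X + y) (Σℤ.∑-distrib-+ (λ j → - a₀ * (sign j * a′ j * G (suc j) zero)) (λ j → sign j * a′ j * U j)) ⟩
    1ℤ * a₀ * X + (sumℤ (λ j → - a₀ * (sign j * a′ j * G (suc j) zero)) + sumℤ (λ j → sign j * a′ j * U j))
      ≡⟨ cong₂ (λ x y → 1ℤ * a₀ * X + (x + y))
           (trans (sym (Σℤ.*-distribˡ-sum (- a₀) (λ j → sign j * a′ j * G (suc j) zero)))
                  (cong (- a₀ *_) (Σℤ.sum-cong-≗ λ j → cong (sign j * a′ j *_) (sym (G-sym j)))))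
           (alternating-sum a′ G′ G-rest) ⟩
    1ℤ * a₀ * X + (- a₀ * X + 0ℤ)
      ≡⟨ cancel a₀ X ⟩
    0ℤ ∎
    where
    open ≡-Reasoning
    a₀ : ℤ
    a₀ = a zero
    a′ : Vector ℤ (suc n)
    a′ j = a (suc j)
    G′ : Fin (suc n) → Fin n → ℤ
    G′ j l = G (suc j) (suc l)
    X : ℤ
    X = sumℤ (λ l → sign l * a′ l * G zero l)
    U : Vector ℤ (suc n)
    U j = sumℤ (λ l → sign l * a′ (punchIn j l) * G′ j l)
    pull : ∀ s x y → - 1ℤ * s * x * y ≡ - 1ℤ * (s * x * y)
    pull = solve-∀
    negate-inner : ∀ j → sumℤ (λ l → sign (suc l) * a′ (punchIn j l) * G′ j l) ≡ - 1ℤ * U j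
    negate-inner j = trans (Σℤ.sum-cong-≗ λ l → pull (sign l) (a′ (punchIn j l)) (G′ j l))
                           (sym (Σℤ.*-distribˡ-sum (- 1ℤ) (λ l → sign l * a′ (punchIn j l) * G′ j l)))
    split : ∀ s x y g u → - 1ℤ * s * x * (1ℤ * y * g + - 1ℤ * u) ≡ - y * (s * x * g) + s * x * u
    split = solve-∀
    cancel : ∀ x y → 1ℤ * x * y + (- x * y + 0ℤ) ≡ 0ℤ
    cancel = solve-∀

  -- Expanding along both equal rows gives a double sum over ordered pairs of columns, whose
  -- remaining minors depend only on the unordered pair.
  det-equal-rows₀₁ : (M : Matrix (suc (suc n)) (suc (suc n))) → M zero ≗ M (suc zero) → det M ≡ 0ℤ
  det-equal-rows₀₁ {n} M eq = trans
    (Σℤ.sum-cong-≗ {suc (suc n)} λ j → cong (sign j * M zero j *_) (Σℤ.sum-cong-≗ λ l → cong (λ x → sign l * x * G j l) (sym (eq (punchIn j l)))))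
    (alternating-sum (M zero) G
      (unordered-pairs (λ c → det λ i k → M (suc (suc i)) (c k))
         (λ c≗d → det-cong λ i k → cong (M (suc (suc i))) (c≗d k)) G (λ _ _ → refl)))
    where
    G : Fin (suc (suc n)) → Fin (suc n) → ℤ
    G j l = det λ i k → M (suc (suc i)) (punchIn j (punchIn l k))

  -- A predicate on the size, so that the two following lemmas can take the smaller size as a
  -- hypothesis.
  Alternating : ℕ → Set
  Alternating n = (M : Matrix n n) (i k : Fin n) → i ≢ k → M i ≗ M k → det M ≡ 0ℤ

  alternating-lower : Alternating n → (M : Matrix (suc n) (suc n)) (i k : Fin n) → i ≢ k →
                      M (suc i) ≗ M (suc k) → det M ≡ 0ℤ
  alternating-lower {n} alt M i k i≢k eq = begin
    sumℤ (λ j → sign j * M zero j * det (minor M j))  ≡⟨ Σℤ.sum-cong-≗ (λ j → trans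
                                                           (cong (sign j * M zero j *_) (alt (minor M j) i k i≢k (eq ∘ punchIn j)))
                                                           (ℤ.*-zeroʳ (sign j * M zero j))) ⟩
    sumℤ {suc n} (λ _ → 0ℤ)                           ≡⟨ Σℤ.sum-replicate-zero (suc n) ⟩
    0ℤ                                                ∎
    where open ≡-Reasoning

  -- Adding row 1 to row k and then row k to row 1 reduces to two equal rows below the first.
  alternating-top : Alternating n → (M : Matrix (suc n) (suc n)) (k : Fin n) →
                    M zero ≗ M (suc k) → det M ≡ 0ℤ
  alternating-top {suc n} alt M zero    eq = det-equal-rows₀₁ M eq
  alternating-top {suc n} alt M (suc k) eq = begin
    det M            ≡⟨ ℤ.+-identityʳ (det M) ⟨
    det M + 0ℤ       ≡⟨ cong (λ d → det M + d) Mb≡0 ⟨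
    det M + det Mb   ≡⟨ det-additive r L M Mb
                          (λ j → trans (cong-app (updateAt-updates r M) j)
                             (cong (λ x → M r j + x) (sym (cong-app (updateAt-updates r M) j))))
                          (λ i i≢r j → cong-app (updateAt-minimal i r M i≢r) j)
                          (λ i i≢r j → trans (cong-app (updateAt-minimal i r M i≢r) j) (sym (cong-app (updateAt-minimal i r M i≢r) j))) ⟨
    det L            ≡⟨ ℤ.+-identityˡ (det L) ⟨
    0ℤ + det L       ≡⟨ cong (_+ det L) L₁≡0 ⟨
    -- `a`, the row `r` of `M`, equals row 0; splitting the row `a+b` of `L₂` therefore leaves `L₁`
    -- with equal rows 0 and 1.
    det L₁ + det L   ≡⟨ det-additive 1F L₂ L₁ L (λ j → cong (_+ b j) (sym (eq j)))
                          (λ { zero _ _ → refl ; (suc zero) 1≢1 → contradiction refl 1≢1 ; (suc (suc i)) _ _ → refl })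
                          (λ { zero _ _ → refl ; (suc zero) 1≢1 → contradiction refl 1≢1 ; (suc (suc i)) _ _ → refl }) ⟨
    det L₂           ≡⟨ alternating-lower alt L₂ zero (suc k) (λ ()) (λ j → sym (cong-app (updateAt-updates r M) j)) ⟩
    0ℤ               ∎
    where
    open ≡-Reasoning
    r 1F : Fin (suc (suc n))
    r = suc (suc k)
    1F = suc zero
    b a+b : Vector ℤ (suc (suc n))
    b = M 1F
    a+b j = M r j + b j
    L Mb L₁ L₂ : Matrix (suc (suc n)) (suc (suc n))
    L  = updateAt M r (const a+b)
    Mb = updateAt M r (const b)
    L₁ = updateAt L 1F (const (M zero))
    L₂ = updateAt L 1F (const a+b)
    Mb≡0 : det Mb ≡ 0ℤ
    Mb≡0 = alternating-lower alt Mb zero (suc k) (λ ()) (λ j → sym (cong-app (updateAt-updates r M) j))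
    L₁≡0 : det L₁ ≡ 0ℤ
    L₁≡0 = det-equal-rows₀₁ L₁ (λ _ → refl)

  det-alternating : Alternating n
  det-alternating M zero    zero    0≢0 eq = contradiction refl 0≢0
  det-alternating M zero    (suc k) _   eq = alternating-top det-alternating M k eq
  det-alternating M (suc i) zero    _   eq = alternating-top det-alternating M i (sym ∘ eq)
  det-alternating M (suc i) (suc k) i≢k eq = alternating-lower det-alternating M i k (i≢k ∘ cong suc) eq

  -- The `d` with this property annihilate the cokernel of `A` and form an ideal of ℤ. It contains
  -- the maximal minors, and surjectivity of `A` on integral vectors means that it contains 1.
  Solvable : Matrix m n → ℤ → Set
  Solvable {m} {n} A d = (b : Vector ℤ m) → ∃[ x ] (∀ i → (A ·ℤ x) i ≡ d * b i)

  -- Cramer's rule, with the cofactor of (i , j) written as the determinant of M with row i replaced by a unit vector.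
  det-solvable : (M : Matrix n n) → Solvable M (det M)
  det-solvable {n} M b = (λ j → sumℤ (λ i → D i (unit j) * b i)) , λ k → begin
    sumℤ (λ j → M k j * sumℤ (λ i → D i (unit j) * b i))
      ≡⟨ Σℤ.sum-product-assoc (M k) (λ j i → D i (unit j)) b ⟩
    sumℤ (λ i → sumℤ (λ j → M k j * D i (unit j)) * b i)
      ≡⟨ Σℤ.sum-cong-≗ (λ i → cong (_* b i) (D-linear i (M k))) ⟨
    sumℤ (λ i → D i (M k) * b i)
      ≡⟨ Σℤ.sum-single (λ i → D i (M k) * b i) k (λ i i≢k → trans (cong (_* b i) (D-other i≢k)) (ℤ.*-zeroˡ (b i))) ⟩
    D k (M k) * b k
      ≡⟨ cong (_* b k) (det-cong λ i j → cong-app (updateAt-id-local k M refl i) j) ⟩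
    det M * b k ∎
    where
    open ≡-Reasoning
    D : Fin n → Vector ℤ n → ℤ
    D i w = det (updateAt M i (const w))
    D-linear : ∀ i w → D i w ≡ sumℤ (λ j → w j * D i (unit j))
    D-linear i w = det-linear i w (updateAt M i (const w)) (λ j → updateAt M i (const (unit j)))
      (λ l → trans (cong-app (updateAt-updates i M) l) (trans (sym (sum-unit w l))
         (Σℤ.sum-cong-≗ λ j → cong (w j *_) (sym (cong-app (updateAt-updates i M) l)))))
      (λ j i′ i′≢i l → trans (cong-app (updateAt-minimal i′ i M i′≢i) l) (sym (cong-app (updateAt-minimal i′ i M i′≢i) l)))
    D-other : ∀ {i k} → i ≢ k → D i (M k) ≡ 0ℤ
    D-other {i} {k} i≢k = det-alternating (updateAt M i (const (M k))) i k i≢k λ j →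
      trans (cong-app (updateAt-updates i M) j) (sym (cong-app (updateAt-minimal k i M (i≢k ∘ sym)) j))

  -- The solution of the square system is spread over the chosen columns. Coefficients of a repeated
  -- column add up, so `c` may be any map.
  minor-solvable : (A : Matrix m n) (c : Fin m → Fin n) → Solvable A (det λ i j → A i (c j))
  minor-solvable A c b with x , Ax≡db ← det-solvable (λ i j → A i (c j)) b
    = (λ j → sumℤ (λ k → unit j (c k) * x k)) , λ i →
      trans (Σℤ.sum-product-assoc (A i) (λ j k → unit j (c k)) x)
            (trans (Σℤ.sum-cong-≗ λ k → cong (_* x k) (sum-unit (A i) (c k))) (Ax≡db i))

  ·ℤ-combination : (A : Matrix m n) (u v : ℤ) (x y : Vector ℤ n) (i : Fin m) →
                   (A ·ℤ (λ j → u * x j + v * y j)) i ≡ u * (A ·ℤ x) i + v * (A ·ℤ y) i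
  ·ℤ-combination A u v x y i = begin
    sumℤ (λ j → A i j * (u * x j + v * y j))
      ≡⟨ Σℤ.sum-cong-≗ (λ j → expand (A i j) u v (x j) (y j)) ⟩
    sumℤ (λ j → u * (A i j * x j) + v * (A i j * y j))
      ≡⟨ Σℤ.∑-distrib-+ (λ j → u * (A i j * x j)) (λ j → v * (A i j * y j)) ⟩
    sumℤ (λ j → u * (A i j * x j)) + sumℤ (λ j → v * (A i j * y j))
      ≡⟨ cong₂ _+_ (Σℤ.*-distribˡ-sum u (λ j → A i j * x j)) (Σℤ.*-distribˡ-sum v (λ j → A i j * y j)) ⟨
    u * (A ·ℤ x) i + v * (A ·ℤ y) i ∎
    where
    open ≡-Reasoning
    expand : ∀ a u v x y → a * (u * x + v * y) ≡ u * (a * x) + v * (a * y)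
    expand = solve-∀

  solvable-combination : (A : Matrix m n) (u v d e : ℤ) → Solvable A d → Solvable A e → Solvable A (u * d + v * e)
  solvable-combination A u v d e solve-d solve-e b with solve-d b | solve-e b
  ... | x , Ax≡db | y , Ay≡eb = (λ j → u * x j + v * y j) , λ i →
    trans (·ℤ-combination A u v x y i)
          (trans (cong₂ (λ s t → u * s + v * t) (Ax≡db i) (Ay≡eb i)) (collect u v d e (b i)))
    where
    collect : ∀ u v d e b → u * (d * b) + v * (e * b) ≡ (u * d + v * e) * b
    collect = solve-∀

  ∣i∣-multiple : ∀ i → ∃[ u ] + ℤ.∣ i ∣ ≡ u * i
  ∣i∣-multiple (+ n)    = 1ℤ , sym (ℤ.*-identityˡ (+ n))
  ∣i∣-multiple -[1+ n ] = - 1ℤ , sym (ℤ.-1*i≡-i -[1+ n ])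

  pos-identity : ∀ g x m y n → g ℕ.+ y ℕ.* n ≡ x ℕ.* m → + g ≡ + x * + m + - + y * + n
  pos-identity g x m y n eq = begin
    + g                                    ≡⟨ insert (+ g) (+ y) (+ n) ⟩
    + g + + y * + n + - + y * + n          ≡⟨ cong (λ e → + g + e + - + y * + n) (ℤ.pos-* y n) ⟨
    + (g ℕ.+ y ℕ.* n) + - + y * + n        ≡⟨ cong (λ e → + e + - + y * + n) eq ⟩
    + (x ℕ.* m) + - + y * + n              ≡⟨ cong (_+ - + y * + n) (ℤ.pos-* x m) ⟩
    + x * + m + - + y * + n                ∎
    where
    open ≡-Reasoning
    insert : ∀ g y n → g ≡ g + y * n + - y * n
    insert = solve-∀

  bézout : ∀ i j → ∃[ u ] ∃[ v ] + gcd ℤ.∣ i ∣ ℤ.∣ j ∣ ≡ u * i + v * j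
  bézout i j with ∣i∣-multiple i | ∣i∣-multiple j | Bézout.identity (gcd-GCD ℤ.∣ i ∣ ℤ.∣ j ∣)
  ... | s , si | t , tj | Bézout.+- x y eq = + x * s , - + y * t ,
    trans (pos-identity _ x ℤ.∣ i ∣ y ℤ.∣ j ∣ eq) (trans (cong₂ (λ a b → + x * a + - + y * b) si tj) (regroup (+ x) s i (- + y) t j))
    where
    regroup : ∀ x s i y t j → x * (s * i) + y * (t * j) ≡ x * s * i + y * t * j
    regroup = solve-∀
  ... | s , si | t , tj | Bézout.-+ x y eq = - + x * s , + y * t ,
    trans (pos-identity _ y ℤ.∣ j ∣ x ℤ.∣ i ∣ eq) (trans (cong₂ (λ a b → + y * b + - + x * a) si tj) (regroup (- + x) s i (+ y) t j))
    where
    regroup : ∀ x s i y t j → y * (t * j) + x * (s * i) ≡ x * s * i + y * t * j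
    regroup = solve-∀

  -- Iterated gcd: Bézout's identity keeps each gcd inside the ideal, starting from 0 for the empty
  -- family.
  ideal-generator : (I : ℤ → Set) → I 0ℤ → (∀ u v d e → I d → I e → I (u * d + v * e)) →
                    (f : Vector ℤ n) → (∀ k → I (f k)) → ∃[ g ] (I g × (∀ k → g ℤ.∣ f k))
  ideal-generator {zero}  I I0 I-comb f If = 0ℤ , I0 , λ ()
  ideal-generator {suc n} I I0 I-comb f If
    with g , Ig , g∣ ← ideal-generator I I0 I-comb (f ∘ suc) (If ∘ suc)
    with u , v , eq ← bézout (f zero) g
    = + gcd ℤ.∣ f zero ∣ ℤ.∣ g ∣ , subst I (sym eq) (I-comb u v (f zero) g (If zero) Ig) , λ
      { zero    → gcd[m,n]∣m ℤ.∣ f zero ∣ ℤ.∣ g ∣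
      ; (suc k) → ∣-trans (gcd[m,n]∣n ℤ.∣ f zero ∣ ℤ.∣ g ∣) (g∣ k) }

  -- Applied twice: to the multiples `d` for which `A x = d b` is solvable, and to the `d` for which
  -- `d w` is an integer multiple of `z`.
  ideal-unit : (I : ℤ → Set) → I 0ℤ → (∀ u v d e → I d → I e → I (u * d + v * e)) →
               (f : Vector ℤ n) → (∀ k → I (f k)) → (∀ g → (∀ k → g ℤ.∣ f k) → g ℤ.∣ 1ℤ) → I 1ℤ
  ideal-unit I I0 I-comb f If coprime
    with g , Ig , g∣f ← ideal-generator I I0 I-comb f If
    with u , ug ← ∣i∣-multiple g
    -- `g` divides 1, so `g` times its sign `u` is 1.
    = subst I (trans (drop u g) (trans (sym ug) (cong +_ (∣1⇒≡1 (coprime g g∣f))))) (I-comb u 0ℤ g g Ig Ig)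
    where
    drop : ∀ u g → u * g + 0ℤ * g ≡ u * g
    drop = solve-∀

  solvable-zero : (A : Matrix m n) → Solvable A 0ℤ
  solvable-zero {n = n} A b =
    (λ _ → 0ℤ) , λ i → trans (Σℤ.sum-cong-≗ λ j → ℤ.*-zeroʳ (A i j)) (Σℤ.sum-replicate-zero n)

  -- All maps of columns are listed, not only the increasing ones: they are enumerated by a `Fin`,
  -- as `ideal-unit` requires, and include every choice that enters the gcd hypothesis.
  minors : Matrix m n → Vector ℤ (n ℕ.^ m)
  minors {m} {n} A k = det λ i j → A i (finToFun {n} {m} k j)

  minors-coprime : (A : Matrix m n) → IsGCD (maximalMinor A) 1ℤ → ∀ g → (∀ k → g ℤ.∣ minors A k) → g ℤ.∣ 1ℤ
  minors-coprime {m} {n} A (_ , coprime) g g∣minors = coprime g λ (c , _) → subst (g ℤ.∣_)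
    (det-cong {M = λ i j → A i (finToFun {n} {m} (funToFin c) j)} {N = λ i j → A i (c j)} 
      λ i j → cong (A i) (finToFun-funToFin c j))
    (g∣minors (funToFin c))

  solvable-one : (A : Matrix m n) → IsGCD (maximalMinor A) 1ℤ → Solvable A 1ℤ
  solvable-one {m} {n} A gcd≡1 = ideal-unit (Solvable A) (solvable-zero A) (solvable-combination A)
    (minors A) (λ k → minor-solvable A (finToFun {n} {m} k)) (minors-coprime A gcd≡1)

  ·ℤ-surjective : (A : Matrix m n) → IsGCD (maximalMinor A) 1ℤ → (b : Vector ℤ m) → ∃[ x ] (A ·ℤ x) ≗ b
  ·ℤ-surjective A gcd≡1 b =
    let x , Ax≡b = solvable-one A gcd≡1 b in x , λ i → trans (Ax≡b i) (ℤ.*-identityˡ (b i))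

-- Rational arithmetic

open import Data.Rational.Base using (_/_; _+_; _*_; _-_; -_; _≤_; _<_; *≤*; *<*)
open +-*-Solver

ι : ℤ → ℚ
ι i = i / 1

-- `i / 1` does not reduce for a variable `i`; in constructor form, sums, products and comparisons
-- compute on numerators.
ι-mkℚ : ∀ i → ι i ≡ mkℚ i 0 (ℕ.sym (1-coprimeTo ℤ.∣ i ∣))
ι-mkℚ i = ℚ.↥p/↧p≡p (mkℚ i 0 (ℕ.sym (1-coprimeTo ℤ.∣ i ∣)))

ι-+ : ∀ i j → ι (i ℤ.+ j) ≡ ι i + ι j
ι-+ i j = begin
  ι (i ℤ.+ j)                        ≡⟨ cong₂ (λ x y → ι (x ℤ.+ y)) (ℤ.*-identityʳ i) (ℤ.*-identityʳ j) ⟨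
  ι (i ℤ.* 1ℤ ℤ.+ j ℤ.* 1ℤ)          ≡⟨ cong₂ _+_ (ι-mkℚ i) (ι-mkℚ j) ⟨
  ι i + ι j                          ∎
  where open ≡-Reasoning

ι-* : ∀ i j → ι (i ℤ.* j) ≡ ι i * ι j
ι-* i j = sym (cong₂ _*_ (ι-mkℚ i) (ι-mkℚ j))

ι-neg : ∀ i → ι (ℤ.- i) ≡ - ι i
ι-neg (+ 0)        = refl
ι-neg (+ suc n)    = refl
ι-neg -[1+ n ]     = sym (neg-involutive (ι (+ suc n)))
  where
  neg-involutive : ∀ p → - - p ≡ p
  neg-involutive = solve 1 (λ p → :- (:- p) := p) refl

ι-mono-≤ : i ℤ.≤ j → ι i ≤ ι j
ι-mono-≤ {i} {j} i≤j = subst₂ _≤_ (sym (ι-mkℚ i)) (sym (ι-mkℚ j)) (*≤* (ℤ.*-monoʳ-≤-nonNeg 1ℤ i≤j))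

ι-cancel-< : ι i < ι j → i ℤ.< j
ι-cancel-< {i} {j} ιi<ιj with subst₂ _<_ (ι-mkℚ i) (ι-mkℚ j) ιi<ιj
... | *<* i<j = subst₂ ℤ._<_ (ℤ.*-identityʳ i) (ℤ.*-identityʳ j) i<j

ι-injective : ι i ≡ ι j → i ≡ j
ι-injective {i} {j} eq = trans (cong ℚ.↥_ (sym (ι-mkℚ i))) (trans (cong ℚ.↥_ eq) (cong ℚ.↥_ (ι-mkℚ j)))

floor-≤ : ∀ p → ι (ℚ.floor p) ≤ p
floor-≤ p@(mkℚ n d-1 _) = subst (_≤ p) (sym (ι-mkℚ (ℚ.floor p)))
  (*≤* (ℤ.≤-trans (ℤ.[n/d]*d≤n n (+ suc d-1)) (ℤ.≤-reflexive (sym (ℤ.*-identityʳ n)))))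

<-floor : ∀ p → p < ι (ℚ.floor p) + 1ℚ
<-floor p@(mkℚ n d-1 _) = subst (p <_)
  (trans (sym (ι-mkℚ (ℤ.suc (ℚ.floor p)))) (trans (ι-+ 1ℤ (ℚ.floor p)) (ℚ.+-comm 1ℚ (ι (ℚ.floor p)))))
  (*<* (subst₂ ℤ._<_ (sym (ℤ.*-identityʳ n)) (cong (λ k → ℤ.suc k ℤ.* + suc d-1) (sym (ℤ.div-pos-is-/ℕ n (suc d-1))))
    (ℤ.n<s[n/ℕd]*d n (suc d-1))))

toℚᵘ-/ : ∀ i n .{{_ : ℕ.NonZero n}} → ℚ.toℚᵘ (i / n) ℚᵘ.≃ (i ℚᵘ./ n)
toℚᵘ-/ i (suc n) = ℚ.toℚᵘ-fromℚᵘ (ℚᵘ.mkℚᵘ i n)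

-- Proved on unnormalised rationals, where no gcd blocks the computation. It isolates the
-- denominator as the single factor `1ℤ / n`, which the ring solver can treat as a variable.
/-scale : ∀ i n .{{_ : ℕ.NonZero n}} → (i / n) ≡ ι i * (1ℤ / n)
/-scale i n@(suc n-1) = ℚ.toℚᵘ-injective (begin
  ℚ.toℚᵘ (i / n)                        ≈⟨ toℚᵘ-/ i n ⟩
  i ℚᵘ./ n                              ≈⟨ ℚᵘ.*≡* (cong₂ ℤ._*_ (sym (ℤ.*-identityʳ i)) (cong +_ (ℕ.+-identityʳ n))) ⟩
  (i ℚᵘ./ 1) ℚᵘ.* (1ℤ ℚᵘ./ n)           ≈⟨ ℚᵘ.*-cong (toℚᵘ-/ i 1) (toℚᵘ-/ 1ℤ n) ⟨
  ℚ.toℚᵘ (ι i) ℚᵘ.* ℚ.toℚᵘ (1ℤ / n)     ≈⟨ ℚ.toℚᵘ-homo-* (ι i) (1ℤ / n) ⟨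
  ℚ.toℚᵘ (ι i * (1ℤ / n))               ∎)
  where open ℚᵘ.≃-Reasoning

n/n≡1 : ∀ n .{{_ : ℕ.NonZero n}} → (+ n / n) ≡ 1ℚ
n/n≡1 n@(suc n-1) = ℚ.toℚᵘ-injective (ℚᵘ.≃-trans (toℚᵘ-/ (+ n) n) (ℚᵘ.*≡* (ℤ.*-comm (+ n) 1ℤ)))

-- Inequalities p ≤ q over ℚ are reduced to a ring identity q ≡ p + t in which t is a sum of products of nonnegative terms.
by-≤ : 0ℚ ≤ t → q ≡ p + t → p ≤ q
by-≤ {t} {q} {p} 0≤t refl = subst (_≤ p + t) (ℚ.+-identityʳ p) (ℚ.+-monoʳ-≤ p 0≤t)

by-< : 0ℚ < t → q ≡ p + t → p < q
by-< {t} {q} {p} 0<t refl = subst (_< p + t) (ℚ.+-identityʳ p) (ℚ.+-monoʳ-< p 0<t)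

≤-gap : p ≤ q → 0ℚ ≤ q - p
≤-gap {p} {q} p≤q = subst (_≤ q - p) (ℚ.+-inverseʳ p) (ℚ.+-monoˡ-≤ (- p) p≤q)

<-gap : p < q → 0ℚ < q - p
<-gap {p} {q} p<q = subst (_< q - p) (ℚ.+-inverseʳ p) (ℚ.+-monoˡ-< (- p) p<q)

0≤-+ : 0ℚ ≤ p → 0ℚ ≤ q → 0ℚ ≤ p + q
0≤-+ = ℚ.+-mono-≤

0<-+ : 0ℚ < p → 0ℚ ≤ q → 0ℚ < p + q
0<-+ = ℚ.+-mono-<-≤

0≤-* : 0ℚ ≤ p → 0ℚ ≤ q → 0ℚ ≤ p * q
0≤-* {p} {q} 0≤p 0≤q = subst (_≤ p * q) (ℚ.*-zeroʳ p) (ℚ.*-monoˡ-≤-nonNeg p {{ℚ.nonNegative 0≤p}} 0≤q)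

0<-* : 0ℚ < p → 0ℚ < q → 0ℚ < p * q
0<-* {p} {q} 0<p 0<q = subst (_< p * q) (ℚ.*-zeroʳ p) (ℚ.*-monoʳ-<-pos p {{ℚ.positive 0<p}} 0<q)

p≤∣p∣ : ∀ p → p ≤ ℚ.∣ p ∣
p≤∣p∣ p with ℚ.≤-total 0ℚ p
... | inj₁ 0≤p = ℚ.≤-reflexive (sym (ℚ.0≤p⇒∣p∣≡p 0≤p))
... | inj₂ p≤0 = ℚ.≤-trans p≤0 (ℚ.0≤∣p∣ p)

-p≤∣p∣ : ∀ p → - p ≤ ℚ.∣ p ∣
-p≤∣p∣ p = subst (- p ≤_) (ℚ.∣-p∣≡∣p∣ p) (p≤∣p∣ (- p))

∣p∣≤ : p ≤ q → - p ≤ q → ℚ.∣ p ∣ ≤ q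
∣p∣≤ {p} {q} p≤q -p≤q with ℚ.∣p∣≡p∨∣p∣≡-p p
... | inj₁ eq = subst (_≤ q) (sym eq) p≤q
... | inj₂ eq = subst (_≤ q) (sym eq) -p≤q

-- Rational sums and continuity of linear maps

module Σℚ = SemiringSum (CommutativeRing.semiring ℚ.+-*-commutativeRing)

sumℚ : Vector ℚ n → ℚ
sumℚ = Σℚ.sum

sum-nonNeg : (f : Vector ℚ n) → (∀ i → 0ℚ ≤ f i) → 0ℚ ≤ sumℚ f
sum-nonNeg {zero}  f 0≤f = ℚ.≤-refl
sum-nonNeg {suc n} f 0≤f = 0≤-+ (0≤f zero) (sum-nonNeg (f ∘ suc) (0≤f ∘ suc))

term≤sum : (f : Vector ℚ n) → (∀ i → 0ℚ ≤ f i) → ∀ i → f i ≤ sumℚ f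
term≤sum {suc n} f 0≤f zero    = by-≤ (sum-nonNeg (f ∘ suc) (0≤f ∘ suc)) refl
term≤sum {suc n} f 0≤f (suc i) = ℚ.≤-trans (term≤sum (f ∘ suc) (0≤f ∘ suc) i) (by-≤ (0≤f zero) (ℚ.+-comm (f zero) _))

∣sum∣≤ : (a d : Vector ℚ n) → (∀ l → ℚ.∣ d l ∣ ≤ t) → ℚ.∣ sumℚ (λ l → a l * d l) ∣ ≤ sumℚ (λ l → ℚ.∣ a l ∣) * t
∣sum∣≤ {zero}  {t} a d d≤t = ℚ.≤-reflexive (sym (ℚ.*-zeroˡ t))
∣sum∣≤ {suc n} {t} a d d≤t = begin
  ℚ.∣ a₀ * d₀ + sumℚ (λ l → a (suc l) * d (suc l)) ∣
    ≤⟨ ℚ.∣p+q∣≤∣p∣+∣q∣ (a₀ * d₀) (sumℚ (λ l → a (suc l) * d (suc l))) ⟩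
  ℚ.∣ a₀ * d₀ ∣ + ℚ.∣ sumℚ (λ l → a (suc l) * d (suc l)) ∣
    ≤⟨ ℚ.+-mono-≤ head-≤ (∣sum∣≤ (a ∘ suc) (d ∘ suc) (d≤t ∘ suc)) ⟩
  ℚ.∣ a₀ ∣ * t + sumℚ (λ l → ℚ.∣ a (suc l) ∣) * t
    ≡⟨ ℚ.*-distribʳ-+ t ℚ.∣ a₀ ∣ (sumℚ (λ l → ℚ.∣ a (suc l) ∣)) ⟨
  sumℚ (λ l → ℚ.∣ a l ∣) * t ∎
  where
  open ℚ.≤-Reasoning
  a₀ d₀ : ℚ
  a₀ = a zero
  d₀ = d zero
  head-≤ : ℚ.∣ a₀ * d₀ ∣ ≤ ℚ.∣ a₀ ∣ * t
  head-≤ = ℚ.≤-trans (ℚ.≤-reflexive (ℚ.∣p*q∣≡∣p∣*∣q∣ a₀ d₀))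
                     (ℚ.*-monoˡ-≤-nonNeg ℚ.∣ a₀ ∣ {{ℚ.∣-∣-nonNeg a₀}} (d≤t zero))

-- `W` dominates the sum of absolute values of every row, so `ε = t / W` serves all rows at once;
-- the summand 1 keeps `W` positive.
linear-continuous : (B : Fin n → Fin m → ℚ) → 0ℚ < t →
  ∃[ ε ] (0ℚ < ε × (∀ d → (∀ l → ℚ.∣ d l ∣ ≤ ε) → ∀ j → ℚ.∣ sumℚ (λ l → B j l * d l) ∣ ≤ t))
linear-continuous {n} {m} {t} B 0<t = ε , 0<ε , λ d d≤ε j → begin
  ℚ.∣ sumℚ (λ l → B j l * d l) ∣   ≤⟨ ∣sum∣≤ (B j) d d≤ε ⟩
  row j * ε                        ≤⟨ ℚ.*-monoʳ-≤-nonNeg ε {{ℚ.nonNegative (ℚ.<⇒≤ 0<ε)}} (row≤W j) ⟩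
  W * ε                            ≡⟨ ℚ.*-assoc W (ℚ.1/ W) t ⟨
  W * ℚ.1/ W * t                   ≡⟨ cong (_* t) (ℚ.*-inverseʳ W) ⟩
  1ℚ * t                           ≡⟨ ℚ.*-identityˡ t ⟩
  t                                ∎
  where
  open ℚ.≤-Reasoning
  row : Fin n → ℚ
  row j = sumℚ (λ l → ℚ.∣ B j l ∣)
  0≤tow : ∀ j → 0ℚ ≤ row j
  0≤tow j = sum-nonNeg _ (λ l → ℚ.0≤∣p∣ (B j l))
  W : ℚ
  W = 1ℚ + sumℚ row
  row≤W : ∀ j → row j ≤ W
  row≤W j = ℚ.≤-trans (term≤sum row 0≤tow j) (by-≤ (ℚ.<⇒≤ (ℚ.positive⁻¹ 1ℚ)) (ℚ.+-comm 1ℚ (sumℚ row)))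
  instance
    W>0 : ℚ.Positive W
    W>0 = ℚ.positive (0<-+ (ℚ.positive⁻¹ 1ℚ) (sum-nonNeg row 0≤tow))
    W≢0 : ℚ.NonZero W
    W≢0 = ℚ.pos⇒nonZero W
  ε : ℚ
  ε = ℚ.1/ W * t
  0<ε : 0ℚ < ε
  0<ε = 0<-* (ℚ.positive⁻¹ (ℚ.1/ W) {{ℚ.1/pos⇒pos W}}) 0<t

-- Limits

eventually-map : {P Q : ℕ → Set} → (∀ k → P k → Q k) → Eventually P → Eventually Q
eventually-map f (N , p) = N , λ k N≤k → f k (p k N≤k)

eventually-zip : {P Q : ℕ → Set} → Eventually P → Eventually Q → Eventually λ k → P k × Q k
eventually-zip (M , p) (N , q) = M ℕ.⊔ N , λ k ≤k → p k (ℕ.m⊔n≤o⇒m≤o M N ≤k) , q k (ℕ.m⊔n≤o⇒n≤o M N ≤k)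

eventually-all : {P : Fin n → ℕ → Set} → (∀ j → Eventually (P j)) → Eventually λ k → ∀ j → P j k
eventually-all {zero}  ev = 0 , λ _ _ ()
eventually-all {suc n} ev = eventually-map (λ { _ (p , ps) zero → p ; _ (p , ps) (suc j) → ps j })
  (eventually-zip (ev zero) (eventually-all (ev ∘ suc)))

-- `x ≈ y` unfolds to nullity of the difference of the two sequences. Equations between reals are
-- thus derived by writing one difference as a rational combination of others.
Null : (ℕ → ℚ) → Set
Null e = ∀ ε → 0ℚ < ε → Eventually λ k → ℚ.∣ e k ∣ < ε

null-cong : {d e : ℕ → ℚ} → d ≗ e → Null d → Null e
null-cong d≗e nd ε 0<ε = eventually-map (λ k → subst (λ x → ℚ.∣ x ∣ < ε) (d≗e k)) (nd ε 0<ε)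

null-zero : Null (λ _ → 0ℚ)
null-zero ε 0<ε = 0 , λ _ _ → 0<ε

null-+ : {d e : ℕ → ℚ} → Null d → Null e → Null (λ k → d k + e k)
null-+ {d} {e} nd ne ε 0<ε = eventually-map
  (λ k (∣d∣< , ∣e∣<) → ℚ.≤-<-trans (ℚ.∣p+q∣≤∣p∣+∣q∣ (d k) (e k))
     (ℚ.<-≤-trans (ℚ.+-mono-< ∣d∣< ∣e∣<) (ℚ.≤-reflexive (Cauchy.halves ε))))
  (eventually-zip (nd (½ * ε) (Cauchy.half-pos ε 0<ε)) (ne (½ * ε) (Cauchy.half-pos ε 0<ε)))

null-* : ∀ c {e : ℕ → ℚ} → Null e → Null (λ k → c * e k)
null-* c {e} ne ε 0<ε = eventually-map (λ k ∣e∣<δ → begin-strict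
    ℚ.∣ c * e k ∣          ≡⟨ ℚ.∣p*q∣≡∣p∣*∣q∣ c (e k) ⟩
    ℚ.∣ c ∣ * ℚ.∣ e k ∣    ≤⟨ ℚ.*-monoʳ-≤-nonNeg ℚ.∣ e k ∣ {{ℚ.∣-∣-nonNeg (e k)}} c≤C ⟩
    C * ℚ.∣ e k ∣          <⟨ ℚ.*-monoʳ-<-pos C ∣e∣<δ ⟩
    C * (ℚ.1/ C * ε)       ≡⟨ ℚ.*-assoc C (ℚ.1/ C) ε ⟨
    C * ℚ.1/ C * ε         ≡⟨ cong (_* ε) (ℚ.*-inverseʳ C) ⟩
    1ℚ * ε                 ≡⟨ ℚ.*-identityˡ ε ⟩
    ε                      ∎)
  (ne (ℚ.1/ C * ε) (0<-* (ℚ.positive⁻¹ (ℚ.1/ C) {{ℚ.1/pos⇒pos C}}) 0<ε))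
  where
  open ℚ.≤-Reasoning
  C : ℚ
  -- The summand 1 avoids a separate case for `c = 0`.
  C = 1ℚ + ℚ.∣ c ∣
  c≤C : ℚ.∣ c ∣ ≤ C
  c≤C = by-≤ (ℚ.<⇒≤ (ℚ.positive⁻¹ 1ℚ)) (ℚ.+-comm 1ℚ ℚ.∣ c ∣)
  instance
    C>0 : ℚ.Positive C
    C>0 = ℚ.positive (0<-+ (ℚ.positive⁻¹ 1ℚ) (ℚ.0≤∣p∣ c))
    C≢0 : ℚ.NonZero C
    C≢0 = ℚ.pos⇒nonZero C

-- The way back from limits to exact equations: a nonzero constant contradicts nullity at `ε` equal
-- to its own absolute value.
null-const : Null (λ _ → p) → p ≡ 0ℚ
null-const {p} np with 0ℚ ℚ.<? ℚ.∣ p ∣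
... | no  0≮∣p∣ = ℚ.∣p∣≡0⇒p≡0 p (ℚ.≤-antisym (ℚ.≮⇒≥ 0≮∣p∣) (ℚ.0≤∣p∣ p))
... | yes 0<∣p∣ with N , ∣p∣<∣p∣ ← np ℚ.∣ p ∣ 0<∣p∣ = contradiction (∣p∣<∣p∣ N ℕ.≤-refl) (ℚ.<-irrefl refl)

sub≡0⇒≡ : p - q ≡ 0ℚ → p ≡ q
sub≡0⇒≡ {p} {q} eq = trans (Cauchy.split-at q p) (trans (cong (λ x → q + x) eq) (ℚ.+-identityʳ q))

≗⇒≈ : {x y : ℝ} → (∀ k → seq x k ≡ seq y k) → x ≈ y
≗⇒≈ {x} {y} x≗y = mk≈ (null-cong (λ k → sym (trans (cong (_- seq y k) (x≗y k)) (ℚ.+-inverseʳ (seq y k)))) null-zero)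

fromℤ-injective : ∀ {i j} → fromℤ i ≈ fromℤ j → i ≡ j
fromℤ-injective i≈j = ι-injective (sub≡0⇒≡ (null-const (_≈_.close i≈j)))

-- Transfer of sums and matrix products between ℤ, ℚ and ℝ

ι-sum : (f : Vector ℤ n) → ι (sumℤ f) ≡ sumℚ (ι ∘ f)
ι-sum {zero}  f = refl
ι-sum {suc n} f = trans (ι-+ (f zero) (sumℤ (f ∘ suc))) (cong (λ p → ι (f zero) + p) (ι-sum (f ∘ suc)))

seq-sum : (v : Vector ℝ n) (k : ℕ) → seq (sumℝ v) k ≡ sumℚ (λ j → seq (v j) k)
seq-sum {zero}  v k = refl
seq-sum {suc n} v k = cong (λ p → seq (v zero) k + p) (seq-sum (v ∘ suc) k)

infixr 8 _·ℚ_

-- Evaluating `A · x` at an index `k` gives this rational product at the `k`-th terms of `x`, which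
-- is where real linear algebra is carried out.
_·ℚ_ : Matrix m n → Vector ℚ n → Vector ℚ m
(A ·ℚ x) i = sumℚ (λ j → ι (A i j) * x j)

·ℚ-cong : (A : Matrix m n) {x y : Vector ℚ n} → x ≗ y → A ·ℚ x ≗ A ·ℚ y
·ℚ-cong A x≗y i = Σℚ.sum-cong-≗ λ j → cong (ι (A i j) *_) (x≗y j)

·ℚ-+ : (A : Matrix m n) (x y : Vector ℚ n) (i : Fin m) → (A ·ℚ (λ j → x j + y j)) i ≡ (A ·ℚ x) i + (A ·ℚ y) i
·ℚ-+ A x y i = trans (Σℚ.sum-cong-≗ λ j → ℚ.*-distribˡ-+ (ι (A i j)) (x j) (y j))
                     (Σℚ.∑-distrib-+ (λ j → ι (A i j) * x j) (λ j → ι (A i j) * y j))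

·ℚ-scale : (A : Matrix m n) (c : ℚ) (x : Vector ℚ n) (i : Fin m) → (A ·ℚ (λ j → c * x j)) i ≡ c * (A ·ℚ x) i
·ℚ-scale A c x i = trans (Σℚ.sum-cong-≗ λ j → swap (ι (A i j)) c (x j)) (sym (Σℚ.*-distribˡ-sum c (λ j → ι (A i j) * x j)))
  where
  swap : ∀ a c x → a * (c * x) ≡ c * (a * x)
  swap = solve 3 (λ a c x → a :* (c :* x) := c :* (a :* x)) refl

·ℚ-ι : (A : Matrix m n) (x : Vector ℤ n) (i : Fin m) → (A ·ℚ (ι ∘ x)) i ≡ ι ((A ·ℤ x) i)
·ℚ-ι A x i = trans (Σℚ.sum-cong-≗ λ j → sym (ι-* (A i j) (x j))) (sym (ι-sum (λ j → A i j ℤ.* x j)))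

seq-· : (A : Matrix m n) (x : Vector ℝ n) (i : Fin m) (k : ℕ) → seq ((A · x) i) k ≡ (A ·ℚ (λ j → seq (x j) k)) i
seq-· A x i k = seq-sum (λ j → fromℤ (A i j) ℝ.* x j) k

·-fromℤ : (A : Matrix m n) {x : Vector ℤ n} {b : Vector ℤ m} → A ·ℤ x ≗ b → A · fromℤⱽ x ≈ⱽ fromℤⱽ b
·-fromℤ A {x} Ax≗b i = ≗⇒≈ λ k → trans (seq-· A (fromℤⱽ x) i k) (trans (·ℚ-ι A x i) (cong ι (Ax≗b i)))

fromℤ-· : (A : Matrix m n) {x : Vector ℤ n} {b : Vector ℤ m} → A · fromℤⱽ x ≈ⱽ fromℤⱽ b → A ·ℤ x ≗ b
fromℤ-· A {x} {b} Ax≈b i = ι-injective (sub≡0⇒≡ (null-const (null-cong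
  (λ k → cong (_- ι (b i)) (trans (seq-· A (fromℤⱽ x) i k) (·ℚ-ι A x i))) (_≈_.close (Ax≈b i)))))

-- The kernel of A

-- The real `r` is eliminated by cross-multiplication: `z i (w j - r z j) - z j (w i - r z i)` no
-- longer contains `r`, term by term, and is a constant null sequence.
proportional : (r : ℝ) (w z : Vector ℤ n) → fromℤⱽ w ≈ⱽ (λ j → r ℝ.* fromℤ (z j)) → ∀ i j → w j ℤ.* z i ≡ w i ℤ.* z j
proportional r w z w≈rz i j = ι-injective (sub≡0⇒≡ (null-const (null-cong cross
  (null-+ (null-* (ι (z i)) (_≈_.close (w≈rz j))) (null-* (- ι (z j)) (_≈_.close (w≈rz i)))))))
  where
  identity : ∀ zi zj wi wj r → zi * (wj - r * zj) + - zj * (wi - r * zi) ≡ wj * zi - wi * zj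
  identity = solve 5 (λ zi zj wi wj r → zi :* (wj :- r :* zj) :+ (:- zj) :* (wi :- r :* zi) := wj :* zi :- wi :* zj) refl
  cross : ∀ k → ι (z i) * (ι (w j) - seq r k * ι (z j)) + - ι (z j) * (ι (w i) - seq r k * ι (z i)) ≡ ι (w j ℤ.* z i) - ι (w i ℤ.* z j)
  cross k = trans (identity (ι (z i)) (ι (z j)) (ι (w i)) (ι (w j)) (seq r k))
                  (sym (cong₂ _-_ (ι-* (w j) (z i)) (ι-* (w i) (z j))))

-- The integers d for which d w is an integer multiple of z form an ideal containing every z i.
proportional⇒multiple : (w z : Vector ℤ n) → IsGCD z 1ℤ → (∀ i j → w j ℤ.* z i ≡ w i ℤ.* z j) →
                        ∃[ k ] (∀ j → w j ≡ k ℤ.* z j)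
proportional⇒multiple w z (_ , coprime) prop =
  let k , wk = ideal-unit (λ d → ∃[ k ] (∀ j → w j ℤ.* d ≡ k ℤ.* z j))
                 (0ℤ , λ j → ℤ.*-zeroʳ (w j))
                 (λ u v d e (k , wd) (l , we) → u ℤ.* k ℤ.+ v ℤ.* l , λ j →
                    trans (expand (w j) u v d e) (trans (cong₂ (λ x y → u ℤ.* x ℤ.+ v ℤ.* y) (wd j) (we j)) (collect u v k l (z j))))
                 z (λ i → w i , prop i) coprime
  in k , λ j → trans (sym (ℤ.*-identityʳ (w j))) (wk j)
  where
  expand : ∀ w u v d e → w ℤ.* (u ℤ.* d ℤ.+ v ℤ.* e) ≡ u ℤ.* (w ℤ.* d) ℤ.+ v ℤ.* (w ℤ.* e)
  expand = solve-∀
  collect : ∀ u v k l z → u ℤ.* (k ℤ.* z) ℤ.+ v ℤ.* (l ℤ.* z) ≡ (u ℤ.* k ℤ.+ v ℤ.* l) ℤ.* z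
  collect = solve-∀

kernel-multiple : (A : Matrix m n) (z : Vector ℤ n) → IsPrimitiveKernelGenerator A z →
                  (w : Vector ℤ n) → A ·ℤ w ≗ replicate m 0ℤ → ∃[ k ] (∀ j → w j ≡ k ℤ.* z j)
kernel-multiple A z (gcd≡1 , ker) w Aw≡0 =
  let r , w≈rz = Equivalence.to (ker (fromℤⱽ w)) (·-fromℤ A {w} {replicate _ 0ℤ} Aw≡0)
  in proportional⇒multiple w z gcd≡1 (proportional r w z w≈rz)

multiple-kernel : (A : Matrix m n) (z : Vector ℤ n) → IsPrimitiveKernelGenerator A z →
                  (k : ℤ) → A ·ℤ (λ j → k ℤ.* z j) ≗ replicate m 0ℤ
multiple-kernel A z (_ , ker) k = fromℤ-· A {λ j → k ℤ.* z j} {replicate _ 0ℤ}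
  (Equivalence.from (ker (fromℤⱽ λ j → k ℤ.* z j)) (fromℤ k , λ j → ≗⇒≈ λ _ → ι-* k (z j)))

HasPointedKernel : Matrix m n → Set
HasPointedKernel {m} {n} A = ∀ x → P A (replicate m 0ℤ) x ⇔ x ≈ⱽ replicate n 0ℝ

fromℤ-nonNeg : ∀ {i} → 0ℤ ℤ.≤ i → 0ℝ ℝ.≤ fromℤ i
fromℤ-nonNeg {i} 0≤i = mk≤ λ ε 0<ε → 0 , λ _ _ → by-< (0<-+ 0<ε (ι-mono-≤ 0≤i)) (trans (ℚ.+-comm (ι i) ε) (sym (ℚ.+-identityˡ _)))

nonNeg-kernel : (A : Matrix m n) → HasPointedKernel A → (w : Vector ℤ n) → (∀ j → 0ℤ ℤ.≤ w j) →
                A ·ℤ w ≗ replicate m 0ℤ → ∀ j → w j ≡ 0ℤ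
nonNeg-kernel A pointed w 0≤w Aw≡0 j =
  fromℤ-injective (Equivalence.to (pointed (fromℤⱽ w)) ((λ j → fromℤ-nonNeg (0≤w j)) , ·-fromℤ A {w} {replicate _ 0ℤ} Aw≡0) j)

nonNeg-or-negative : (w : Vector ℤ n) → (∀ j → 0ℤ ℤ.≤ w j) ⊎ ∃[ i ] w i ℤ.< 0ℤ
nonNeg-or-negative w with any? (λ i → w i ℤ.<? 0ℤ)
... | yes ∃i = inj₂ ∃i
... | no  ∄i = inj₁ λ j → ℤ.≮⇒≥ λ wj<0 → ∄i (j , wj<0)

-- Both signs occur in z: take k = -1 and k = 1.
negative-entry : (A : Matrix m n) → HasPointedKernel A → (z : Vector ℤ n) → IsPrimitiveKernelGenerator A z →
                 (k : ℤ) .{{_ : ℤ.NonZero k}} → ∃[ i ] k ℤ.* z i ℤ.< 0ℤ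
negative-entry A pointed z gen k = [ (λ 0≤kz → contradiction (proj₁ gen) (not-primitive 0≤kz)) , id ]′
  (nonNeg-or-negative (λ i → k ℤ.* z i))
  where
  z≡0 : (∀ j → 0ℤ ℤ.≤ k ℤ.* z j) → ∀ j → z j ≡ 0ℤ
  z≡0 0≤kz j = ℤ.*-cancelˡ-≡ k (z j) 0ℤ (trans
    (nonNeg-kernel A pointed (λ j → k ℤ.* z j) 0≤kz (multiple-kernel A z gen k) j) (sym (ℤ.*-zeroʳ k)))
  not-primitive : (∀ j → 0ℤ ℤ.≤ k ℤ.* z j) → ¬ IsGCD z 1ℤ
  not-primitive 0≤kz (_ , coprime) =
    -- If all entries vanish, 0 is a common divisor and would divide 1.
    contradiction (0∣⇒≡0 (coprime 0ℤ λ j → subst (0ℤ ℤ.∣_) (sym (z≡0 0≤kz j)) ∣-refl)) λ ()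

argmax : (f : Fin n → ℕ) {Q : Fin n → Set} → (∀ i → Dec (Q i)) → ∃[ i ] Q i →
         ∃[ i ] (Q i × (∀ j → Q j → f j ℕ.≤ f i))
argmax {suc n} f {Q} Q? (i , Qi) with any? (Q? ∘ suc) | Q? zero
argmax {suc n} f {Q} Q? (zero  , Q0) | no ∄  | _ = zero , Q0 , λ { zero _ → ℕ.≤-refl ; (suc j) Qj → contradiction (j , Qj) ∄ }
argmax {suc n} f {Q} Q? (suc i , Qi) | no ∄  | _ = contradiction (i , Qi) ∄
... | yes ∃ | no ¬Q0 with k , Qk , max ← argmax (f ∘ suc) (Q? ∘ suc) ∃
  = suc k , Qk , λ { zero Q0 → contradiction Q0 ¬Q0 ; (suc j) Qj → max j Qj }
... | yes ∃ | yes Q0 with k , Qk , max ← argmax (f ∘ suc) (Q? ∘ suc) ∃ | ℕ.≤-total (f zero) (f (suc k))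
... | inj₁ f0≤fk = suc k , Qk , λ { zero _ → f0≤fk ; (suc j) Qj → max j Qj }
... | inj₂ fk≤f0 = zero , Q0 , λ { zero _ → ℕ.≤-refl ; (suc j) Qj → ℕ.≤-trans (max j Qj) fk≤f0 }

-- Rounding the kernel coefficient, and the extremal point

module Frobenius (z⁺ z⁻ : ℕ) .{{nz : ℕ.NonZero (z⁺ ℕ.+ z⁻)}} where

  -- The division by `z⁺ + z⁻` becomes a variable `κ` subject to `κ * (a + b) = 1`, so that each
  -- estimate is a polynomial identity with nonnegative terms.
  a b κ : ℚ
  a = ι (+ z⁺)
  b = ι (+ z⁻)
  κ = 1ℤ / (z⁺ ℕ.+ z⁻)

  0≤a : 0ℚ ≤ a
  0≤a = ι-mono-≤ {0ℤ} {+ z⁺} (ℤ.+≤+ ℕ.z≤n)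

  0≤b : 0ℚ ≤ b
  0≤b = ι-mono-≤ {0ℤ} {+ z⁻} (ℤ.+≤+ ℕ.z≤n)

  0≤κ : 0ℚ ≤ κ
  0≤κ = ℚ.nonNegative⁻¹ κ {{ℚ.normalize-nonNeg 1 (z⁺ ℕ.+ z⁻)}}

  κ-inverse : 1ℚ ≡ κ * (a + b)
  κ-inverse = begin
    1ℚ                              ≡⟨ n/n≡1 (z⁺ ℕ.+ z⁻) ⟨
    + (z⁺ ℕ.+ z⁻) / (z⁺ ℕ.+ z⁻)     ≡⟨ /-scale (+ (z⁺ ℕ.+ z⁻)) (z⁺ ℕ.+ z⁻) ⟩
    ι (+ z⁺ ℤ.+ + z⁻) * κ           ≡⟨ cong (_* κ) (ι-+ (+ z⁺) (+ z⁻)) ⟩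
    (a + b) * κ                     ≡⟨ ℚ.*-comm (a + b) κ ⟩
    κ * (a + b)                     ∎
    where open ≡-Reasoning

  value≡ : frobeniusValue z⁺ z⁻ ≡ a * b * κ - 1ℚ
  value≡ = cong (_- 1ℚ) (trans (/-scale (+ (z⁺ ℕ.* z⁻)) (z⁺ ℕ.+ z⁻))
    (cong (_* κ) (trans (cong ι (ℤ.pos-* z⁺ z⁻)) (ι-* (+ z⁺) (+ z⁻)))))

  -- The interval has length `(a + b) * κ = 1`, hence meets every class modulo ℤ; the floor of
  -- `r + a * κ` measures from its left end.
  round : ∀ r → ∃[ k ] (- (a * κ) ≤ r - ι k × r - ι k ≤ b * κ)
  round r = k , by-≤ (≤-gap (floor-≤ (r + a * κ))) (lower r (ι k) a κ) ,
    by-≤ (ℚ.<⇒≤ (<-gap (<-floor (r + a * κ)))) (trans (upper′ a b κ) (trans (cong (_- a * κ) (sym κ-inverse)) (upper r (ι k) (a * κ))))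
    where
    k : ℤ
    k = ℚ.floor (r + a * κ)
    lower : ∀ r k a κ → r - k ≡ - (a * κ) + (r + a * κ - k)
    lower = solve 4 (λ r k a κ → r :- k := :- (a :* κ) :+ (r :+ a :* κ :- k)) refl
    upper′ : ∀ a b κ → b * κ ≡ κ * (a + b) - a * κ
    upper′ = solve 3 (λ a b κ → b :* κ := κ :* (a :+ b) :- a :* κ) refl
    upper : ∀ r k c → 1ℚ - c ≡ r - k + (k + 1ℚ - (r + c))
    upper = solve 3 (λ r k c → con 1ℚ :- c := r :- k :+ (k :+ con 1ℚ :- (r :+ c))) refl

  -- A product on a rectangle is largest at a corner, and the corners `(b * κ , a)` and
  -- `(- (a * κ) , - b)` both give `a * b * κ`. The sign of `d` decides which corner is compared.
  product-≤ : ∀ d x → - (a * κ) ≤ d → d ≤ b * κ → - b ≤ x → x ≤ a → d * x ≤ a * b * κ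
  product-≤ d x aκ≤d d≤bκ b≤x x≤a with ℚ.≤-total 0ℚ d
  ... | inj₁ 0≤d = by-≤ (0≤-+ (0≤-* 0≤d (≤-gap x≤a)) (0≤-* 0≤a (≤-gap d≤bκ))) (identity d x a b κ)
    where
    identity : ∀ d x a b κ → a * b * κ ≡ d * x + (d * (a - x) + a * (b * κ - d))
    identity = solve 5 (λ d x a b κ → a :* b :* κ := d :* x :+ (d :* (a :- x) :+ a :* (b :* κ :- d))) refl
  ... | inj₂ d≤0 = by-≤ (0≤-+ (0≤-* (≤-gap d≤0) (≤-gap b≤x)) (0≤-* 0≤b (≤-gap aκ≤d))) (identity d x a b κ)
    where
    identity : ∀ d x a b κ → a * b * κ ≡ d * x + ((0ℚ - d) * (x - - b) + b * (d - - (a * κ)))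
    identity = solve 5 (λ d x a b κ → a :* b :* κ := d :* x :+ ((con 0ℚ :- d) :* (x :- :- b) :+ b :* (d :- :- (a :* κ)))) refl

  module _ (z : Vector ℤ n) (z≤z⁺ : ∀ j → z j ℤ.≤ + z⁺) (-z⁻≤z : ∀ j → ℤ.- (+ z⁻) ℤ.≤ z j) where

    z≤a : ∀ j → ι (z j) ≤ a
    z≤a j = ι-mono-≤ (z≤z⁺ j)

    -b≤z : ∀ j → - b ≤ ι (z j)
    -b≤z j = subst (_≤ ι (z j)) (ι-neg (+ z⁻)) (ι-mono-≤ (-z⁻≤z j))

    integral-point : ∀ {s} → frobeniusValue z⁺ z⁻ ≤ s → (x : Vector ℤ n) (r : ℚ) →
                     (∀ j → s < ι (x j) + r * ι (z j)) → ∃[ k ] (∀ j → 0ℤ ℤ.≤ x j ℤ.+ k ℤ.* z j)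
    integral-point {s} v≤s x r s< = let k , lower , upper = round r in
      -- The strictness of `s<` matters here: an integer strictly above -1 is nonnegative.
      k , λ j → ℤ.i<j⇒suc[i]≤j {ℤ.- 1ℤ} (ι-cancel-< {ℤ.- 1ℤ} (subst (ι (ℤ.- 1ℤ) <_) (sym (ι-entry k j))
        (by-< (0<-+ (<-gap (s< j)) (0≤-+ (≤-gap (subst (_≤ s) value≡ v≤s))
                (≤-gap (product-≤ (r - ι k) (ι (z j)) lower upper (-b≤z j) (z≤a j)))))
          (identity (ι (x j)) (ι k) (ι (z j)) r s (a * b * κ)))))
      where
      ι-entry : ∀ k j → ι (x j ℤ.+ k ℤ.* z j) ≡ ι (x j) + ι k * ι (z j)
      ι-entry k j = trans (ι-+ (x j) (k ℤ.* z j)) (cong (λ p → ι (x j) + p) (ι-* k (z j)))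
      identity : ∀ x k z r s c → x + k * z ≡ - 1ℚ + (x + r * z - s + (s - (c - 1ℚ) + (c - (r - k) * z)))
      identity = solve 6 (λ x k z r s c → x :+ k :* z :=
        :- con 1ℚ :+ (x :+ r :* z :- s :+ (s :- (c :- con 1ℚ) :+ (c :- (r :- k) :* z)))) refl

    -- At r = z⁻ / (z⁺ + z⁻) the entry of extremal + r z equals the Frobenius value where z j = z⁺ or z j = - z⁻.
    entry : (i : ℤ) → Dec (0ℤ ℤ.≤ i) → ℤ
    entry i (yes _) = + z⁺ ℤ.- i ℤ.- 1ℤ
    entry i (no  _) = + z⁻ ℤ.- 1ℤ

    extremal : Vector ℤ n
    extremal j = entry (z j) (0ℤ ℤ.≤? z j)

    -- The slack is `a * κ * (a - z j)` for `z j ≥ 0` and `b * κ * (z j + b)` otherwise, so it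
    -- vanishes at the extreme entries.
    value≤entry : ∀ j dec → frobeniusValue z⁺ z⁻ ≤ ι (entry (z j) dec) + b * κ * ι (z j)
    value≤entry j (yes _) = subst₂ _≤_ (sym value≡) (cong (λ p → p + b * κ * ι (z j)) (sym ι-entry))
        (by-≤ (0≤-* (0≤-* 0≤a 0≤κ) (≤-gap (z≤a j)))
          (trans (cong (λ u → u * (a - ι (z j)) - 1ℚ + b * κ * ι (z j)) κ-inverse) (identity a b κ (ι (z j)))))
      where
      -- The factor `1ℚ` is kept so that `κ-inverse` can replace it by `κ * (a + b)`.
      ι-entry : ι (+ z⁺ ℤ.- z j ℤ.- 1ℤ) ≡ 1ℚ * (a - ι (z j)) - 1ℚ
      ι-entry = trans (ι-+ (+ z⁺ ℤ.- z j) (ℤ.- 1ℤ)) (cong (_- 1ℚ)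
        (trans (ι-+ (+ z⁺) (ℤ.- z j)) (trans (cong (λ p → a + p) (ι-neg (z j))) (sym (ℚ.*-identityˡ _)))))
      identity : ∀ a b κ z → κ * (a + b) * (a - z) - 1ℚ + b * κ * z ≡ a * b * κ - 1ℚ + a * κ * (a - z)
      identity = solve 4 (λ a b κ z → κ :* (a :+ b) :* (a :- z) :- con 1ℚ :+ b :* κ :* z :=
        a :* b :* κ :- con 1ℚ :+ a :* κ :* (a :- z)) refl
    value≤entry j (no  _) = subst₂ _≤_ (sym value≡) (cong (λ p → p + b * κ * ι (z j)) (sym ι-entry))
        (by-≤ (0≤-* (0≤-* 0≤b 0≤κ) (≤-gap (-b≤z j)))
          (trans (cong (λ u → u * b - 1ℚ + b * κ * ι (z j)) κ-inverse) (identity a b κ (ι (z j)))))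
      where
      ι-entry : ι (+ z⁻ ℤ.- 1ℤ) ≡ 1ℚ * b - 1ℚ
      ι-entry = trans (ι-+ (+ z⁻) (ℤ.- 1ℤ)) (cong (_- 1ℚ) (sym (ℚ.*-identityˡ b)))
      identity : ∀ a b κ z → κ * (a + b) * b - 1ℚ + b * κ * z ≡ a * b * κ - 1ℚ + b * κ * (z - - b)
      identity = solve 4 (λ a b κ z → κ :* (a :+ b) :* b :- con 1ℚ :+ b :* κ :* z := a :* b :* κ :- con 1ℚ :+ b :* κ :* (z :- :- b)) refl

    value≤extremal : ∀ j → frobeniusValue z⁺ z⁻ ≤ ι (extremal j) + b * κ * ι (z j)
    value≤extremal j = value≤entry j (0ℤ ℤ.≤? z j)

    extremal-nonNeg : ∀ j → 0ℤ ℤ.≤ z j → extremal j ≡ + z⁺ ℤ.- z j ℤ.- 1ℤ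
    extremal-nonNeg j 0≤zj = pick (0ℤ ℤ.≤? z j)
      where
      pick : ∀ dec → entry (z j) dec ≡ + z⁺ ℤ.- z j ℤ.- 1ℤ
      pick (yes _)    = refl
      pick (no  0≰zj) = contradiction 0≤zj 0≰zj

    extremal-neg : ∀ j → z j ℤ.< 0ℤ → extremal j ≡ + z⁻ ℤ.- 1ℤ
    extremal-neg j zj<0 = pick (0ℤ ℤ.≤? z j)
      where
      pick : ∀ dec → entry (z j) dec ≡ + z⁻ ℤ.- 1ℤ
      pick (yes 0≤zj) = contradiction zj<0 (ℤ.≤⇒≯ 0≤zj)
      pick (no  _)    = refl

    -- The entry at `i⁺` is `k z⁺ - 1`, which forces `k ≥ 1`; the entry at `i⁻` is `(1 - k) z⁻ - 1`,
    -- which forces `k ≤ 0`.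
    extremal-infeasible : ∀ i⁺ i⁻ → 0ℤ ℤ.< z i⁺ → z i⁺ ≡ + z⁺ → z i⁻ ℤ.< 0ℤ → z i⁻ ≡ ℤ.- (+ z⁻) →
                          ∀ k → ¬ (∀ j → 0ℤ ℤ.≤ extremal j ℤ.+ k ℤ.* z j)
    extremal-infeasible i⁺ i⁻ z⁺>0 z≡z⁺ z⁻<0 z≡-z⁻ k feasible = [ k≰0 , k≱1 ]′ (≤0-or-≥1 k)
      where
      ≤0-or-≥1 : ∀ k → k ℤ.≤ 0ℤ ⊎ 1ℤ ℤ.≤ k
      ≤0-or-≥1 (+ zero)  = inj₁ ℤ.≤-refl
      ≤0-or-≥1 (+ suc n) = inj₂ (ℤ.+≤+ (ℕ.s≤s ℕ.z≤n))
      ≤0-or-≥1 -[1+ n ]  = inj₁ ℤ.-≤+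
      at⁺ : ∀ y k → y ℤ.- y ℤ.- 1ℤ ℤ.+ k ℤ.* y ≡ k ℤ.* y ℤ.- 1ℤ
      at⁺ = solve-∀
      at⁻ : ∀ y k → y ℤ.- 1ℤ ℤ.+ k ℤ.* ℤ.- y ≡ 1ℤ ℤ.* y ℤ.- k ℤ.* y ℤ.- 1ℤ
      at⁻ = solve-∀
      feasible⁺ : 0ℤ ℤ.≤ k ℤ.* + z⁺ ℤ.- 1ℤ
      feasible⁺ = subst (0ℤ ℤ.≤_) (trans (cong (ℤ._+ k ℤ.* z i⁺) (extremal-nonNeg i⁺ (ℤ.<⇒≤ z⁺>0)))
        (trans (cong (λ y → + z⁺ ℤ.- y ℤ.- 1ℤ ℤ.+ k ℤ.* y) z≡z⁺) (at⁺ (+ z⁺) k))) (feasible i⁺)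
      feasible⁻ : 0ℤ ℤ.≤ 1ℤ ℤ.* + z⁻ ℤ.- k ℤ.* + z⁻ ℤ.- 1ℤ
      feasible⁻ = subst (0ℤ ℤ.≤_) (trans (cong₂ (λ x y → x ℤ.+ k ℤ.* y) (extremal-neg i⁻ z⁻<0) z≡-z⁻) (at⁻ (+ z⁻) k)) (feasible i⁻)
      k≰0 : ¬ k ℤ.≤ 0ℤ
      k≰0 k≤0 = contradiction (ℤ.≤-trans feasible⁺ (ℤ.+-monoˡ-≤ (ℤ.- 1ℤ) (ℤ.*-monoʳ-≤-nonNeg (+ z⁺) k≤0))) λ ()
      k≱1 : ¬ 1ℤ ℤ.≤ k
      k≱1 1≤k = contradiction (ℤ.≤-trans feasible⁻ (ℤ.+-monoˡ-≤ (ℤ.- 1ℤ)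
        (ℤ.i≤j⇒i-j≤0 (ℤ.*-monoʳ-≤-nonNeg (+ z⁻) 1≤k)))) λ ()

-- Lattice points of the interior of the shifted cone

open Cauchy using (half-pos)

-- One point of the neighbourhood is enough: `b - δ v` in `t v + C` puts `b` in `(t + δ) v + C`,
-- which turns interiority into a strict inequality. Half of the gap `g` below `ε` bounds the
-- displacement, and the other half witnesses the strict real inequalities.
shift-down : (S : Vector ℝ m → Set) (b : Vector ℤ m) (v : Vector ℚ m) → interior S (fromℤⱽ b) →
             ∃[ δ ] (0ℚ < δ × S (λ i → fromℚ (ι (b i) - v i * δ)))
shift-down {m} S b v (ε , mk< g 0<g (N , g<ε) , inside) = δ , 0<δ , inside (λ i → fromℚ (ι (b i) - v i * δ)) λ i →
    mk< (½ * g) (half-pos g 0<g) (N , λ k N≤k → by-< (0<-+ (<-gap (g<ε k N≤k)) (≤-gap (upper i)))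
      (above (ι (b i)) g (v i * δ) (seq ε k))) ,
    mk< (½ * g) (half-pos g 0<g) (N , λ k N≤k → by-< (0<-+ (<-gap (g<ε k N≤k)) (≤-gap (lower i)))
      (below (ι (b i)) g (v i * δ) (seq ε k)))
  where
  -- `v` is read as a matrix with one column.
  continuity : ∃[ δ ] (0ℚ < δ × (∀ (d : Vector ℚ 1) → (∀ l → ℚ.∣ d l ∣ ≤ δ) → ∀ i → ℚ.∣ sumℚ (λ l → v i * d l) ∣ ≤ ½ * g))
  continuity = linear-continuous (λ i _ → v i) (half-pos g 0<g)
  δ : ℚ
  δ = proj₁ continuity
  0<δ : 0ℚ < δ
  0<δ = proj₁ (proj₂ continuity)
  small : ∀ i → ℚ.∣ v i * δ ∣ ≤ ½ * g
  small i = subst (λ x → ℚ.∣ x ∣ ≤ ½ * g) (ℚ.+-identityʳ (v i * δ))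
    (proj₂ (proj₂ continuity) (λ _ → δ) (λ _ → ℚ.≤-reflexive (ℚ.0≤p⇒∣p∣≡p (ℚ.<⇒≤ 0<δ))) i)
  upper : ∀ i → v i * δ ≤ ½ * g
  upper i = ℚ.≤-trans (p≤∣p∣ (v i * δ)) (small i)
  lower : ∀ i → - (v i * δ) ≤ ½ * g
  lower i = ℚ.≤-trans (-p≤∣p∣ (v i * δ)) (small i)
  above : ∀ b g v ε → b - v + ε ≡ b + ½ * g + (ε - (0ℚ + g) + (½ * g - v))
  above = solve 4 (λ b g v ε → b :- v :+ ε := b :+ con ½ :* g :+ (ε :- (con 0ℚ :+ g) :+ (con ½ :* g :- v))) refl
  below : ∀ b g v ε → b + ε ≡ b - v + ½ * g + (ε - (0ℚ + g) + (½ * g - - v))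
  below = solve 4 (λ b g v ε → b :+ ε := b :- v :+ con ½ :* g :+ (ε :- (con 0ℚ :+ g) :+ (con ½ :* g :- :- v))) refl

columnSum : Matrix m n → Vector ℚ m
columnSum A i = ι ((A ·ℤ replicate _ 1ℤ) i)

-- With `b - δ v = s v + A c`, the vector `X = (s + δ) 1 - x + c` lies in the kernel, so it is `r z`
-- for a real `r`, and `x + r z = (s + δ) 1 + c` exceeds `s`.
cone⇒above : (A : Matrix m n) (z : Vector ℤ n) → IsPrimitiveKernelGenerator A z →
             (b : Vector ℤ m) (x : Vector ℤ n) → A ·ℤ x ≗ b → (s δ : ℚ) → 0ℚ < δ →
             shiftedCone A (fromℚ s) (λ i → fromℚ (ι (b i) - columnSum A i * δ)) →
             ∃[ r ] (∀ j → s < ι (x j) + r * ι (z j))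
cone⇒above {m} {n} A z (_ , ker) b x Ax≡b s δ 0<δ (c′ , (c , 0≤c , c′≈) , y≈) =
  -- The rational witness is a late term of `r`. Half of `δ` absorbs the error `E` of the kernel
  -- equation, the other half the possible negativity of the term of `c`.
  seq r K , λ j → by-< (0<-+ (<-gap (ℚ.≤-<-trans (p≤∣p∣ (E j K)) (proj₁ (late K ℕ.≤-refl j)))) (ℚ.<⇒≤ (<-gap (proj₂ (late K ℕ.≤-refl j)))))
    (final s δ (ι (x j)) (seq (c j) K) (seq r K * ι (z j)))
  where
  X : Vector ℝ n
  X j = fromℚ (s + δ - ι (x j)) ℝ.+ c j
  AX : ∀ i k → seq ((A · X) i) k ≡ (s + δ) * columnSum A i + - 1ℚ * ι (b i) + (A ·ℚ (λ j → seq (c j) k)) i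
  AX i k = begin
    seq ((A · X) i) k
      ≡⟨ seq-· A X i k ⟩
    (A ·ℚ (λ j → s + δ - ι (x j) + seq (c j) k)) i
      ≡⟨ ·ℚ-cong A (λ j → split (s + δ) (ι (x j)) (seq (c j) k)) i ⟩
    (A ·ℚ (λ j → (s + δ) * ι 1ℤ + - 1ℚ * ι (x j) + seq (c j) k)) i
      ≡⟨ ·ℚ-+ A (λ j → (s + δ) * ι 1ℤ + - 1ℚ * ι (x j)) (λ j → seq (c j) k) i ⟩
    (A ·ℚ (λ j → (s + δ) * ι 1ℤ + - 1ℚ * ι (x j))) i + C
      ≡⟨ cong (_+ C) (·ℚ-+ A (λ j → (s + δ) * ι 1ℤ) (λ j → - 1ℚ * ι (x j)) i) ⟩
    (A ·ℚ (λ j → (s + δ) * ι 1ℤ)) i + (A ·ℚ (λ j → - 1ℚ * ι (x j))) i + C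
      ≡⟨ cong₂ (λ p q → p + q + C) (trans (·ℚ-scale A (s + δ) (λ _ → ι 1ℤ) i) (cong ((s + δ) *_) (·ℚ-ι A (replicate _ 1ℤ) i)))
           (trans (·ℚ-scale A (- 1ℚ) (ι ∘ x) i) (cong (- 1ℚ *_) (trans (·ℚ-ι A x i) (cong ι (Ax≡b i))))) ⟩
    (s + δ) * columnSum A i + - 1ℚ * ι (b i) + C ∎
    where
    open ≡-Reasoning
    C : ℚ
    C = (A ·ℚ (λ j → seq (c j) k)) i
    split : ∀ t x c → t - x + c ≡ t * 1ℚ + - 1ℚ * x + c
    split = solve 3 (λ t x c → t :- x :+ c := t :* con 1ℚ :+ (:- con 1ℚ) :* x :+ c) refl
  cone-sum : ∀ i k → seq (sumℝ (λ j → c j ℝ.* fromℤ (A i j))) k ≡ (A ·ℚ (λ j → seq (c j) k)) i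
  cone-sum i k = trans (seq-sum (λ j → c j ℝ.* fromℤ (A i j)) k) (Σℚ.sum-cong-≗ λ j → ℚ.*-comm (seq (c j) k) (ι (A i j)))
  errors : ∀ s δ v b c′ C → - 1ℚ * (b - v * δ - (s * v + c′)) + - 1ℚ * (c′ - C) ≡ (s + δ) * v + - 1ℚ * b + C - 0ℚ
  errors = solve 6 (λ s δ v b c′ C → (:- con 1ℚ) :* (b :- v :* δ :- (s :* v :+ c′)) :+ (:- con 1ℚ) :* (c′ :- C)
                                       := (s :+ δ) :* v :+ (:- con 1ℚ) :* b :+ C :- con 0ℚ) refl
  AX≈0 : A · X ≈ⱽ replicate m 0ℝ
  AX≈0 i = mk≈ (null-cong (λ k → trans
      (cong (λ p → - 1ℚ * (ι (b i) - columnSum A i * δ - (s * columnSum A i + seq (c′ i) k)) + - 1ℚ * (seq (c′ i) k - p)) (cone-sum i k))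
      (trans (errors s δ (columnSum A i) (ι (b i)) (seq (c′ i) k) _) (cong (_- 0ℚ) (sym (AX i k)))))
    (null-+ (null-* (- 1ℚ) (_≈_.close (y≈ i))) (null-* (- 1ℚ) (_≈_.close (c′≈ i)))))
  multiple : ∃[ r ] X ≈ⱽ λ j → r ℝ.* fromℤ (z j)
  multiple = Equivalence.to (ker X) AX≈0
  r : ℝ
  r = proj₁ multiple
  E : Fin n → ℕ → ℚ
  E j k = s + δ - ι (x j) + seq (c j) k - seq r k * ι (z j)
  eventually-late : Eventually λ k → ∀ j → ℚ.∣ E j k ∣ < ½ * δ × 0ℚ < seq (c j) k + ½ * δ
  eventually-late = eventually-all λ j → eventually-zip (_≈_.close (proj₂ multiple j) (½ * δ) (half-pos δ 0<δ))
                                                        (ℝ._≤_.below (0≤c j) (½ * δ) (half-pos δ 0<δ))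
  K : ℕ
  K = proj₁ eventually-late
  late : ∀ k → K ℕ.≤ k → ∀ j → ℚ.∣ E j k ∣ < ½ * δ × 0ℚ < seq (c j) k + ½ * δ
  late = proj₂ eventually-late
  final : ∀ s δ x c rz → x + rz ≡ s + (½ * δ - (s + δ - x + c - rz) + (c + ½ * δ - 0ℚ))
  final = solve 5 (λ s δ x c rz → x :+ rz := s :+ (con ½ :* δ :- (s :+ δ :- x :+ c :- rz) :+ (c :+ con ½ :* δ :- con 0ℚ))) refl

interior⇒above : (A : Matrix m n) (z : Vector ℤ n) → IsPrimitiveKernelGenerator A z →
                 (b : Vector ℤ m) (x : Vector ℤ n) → A ·ℤ x ≗ b → (s : ℚ) →
                 interior (shiftedCone A (fromℚ s)) (fromℤⱽ b) → ∃[ r ] (∀ j → s < ι (x j) + r * ι (z j))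
interior⇒above A z gen b x Ax≡b s int =
  let δ , 0<δ , shifted = shift-down (shiftedCone A (fromℚ s)) b (columnSum A) int
  in cone⇒above A z gen b x Ax≡b s δ 0<δ shifted

-- A right inverse B of A moves X continuously along with the right-hand side.
above⇒interior : (A : Matrix m n) (B : Fin m → Vector ℤ n) → (∀ l → A ·ℤ B l ≗ unit l) →
                 (t : ℝ) (s δ : ℚ) → Eventually (λ k → seq t k ≤ s) → 0ℚ < δ →
                 (b : Vector ℤ m) (X : Vector ℚ n) → A ·ℚ X ≗ ι ∘ b → (∀ j → s + δ ≤ X j) →
                 interior (shiftedCone A t) (fromℤⱽ b)
above⇒interior {m} {n} A B AB≡1 t s δ t≤s 0<δ b X AX≡b s+δ≤X =
  fromℚ ε , mk< (½ * ε) (half-pos ε 0<ε) (0 , λ _ _ → by-< (half-pos ε 0<ε) (halves ε)) , λ y near →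
    (λ i → sumℝ (λ j → c y j ℝ.* fromℤ (A i j))) , (c y , 0≤c y near , λ i → ≗⇒≈ λ _ → refl) , λ i → ≗⇒≈ (y≡ y i)
  where
  continuity : ∃[ ε ] (0ℚ < ε × (∀ d → (∀ l → ℚ.∣ d l ∣ ≤ ε) → ∀ j → ℚ.∣ sumℚ (λ l → ι (B l j) * d l) ∣ ≤ δ))
  continuity = linear-continuous (λ j l → ι (B l j)) 0<δ
  ε : ℚ
  ε = proj₁ continuity
  0<ε : 0ℚ < ε
  0<ε = proj₁ (proj₂ continuity)
  halves : ∀ ε → ε ≡ 0ℚ + ½ * ε + ½ * ε
  halves = solve 1 (λ ε → ε := con 0ℚ :+ con ½ :* ε :+ con ½ :* ε) refl
  d : Vector ℝ m → Fin m → ℕ → ℚ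
  d y l k = seq (y l) k + - ι (b l)
  c : Vector ℝ m → Vector ℝ n
  -- `c y = X - t 1 + B (y - b)`, so `A (c y) = b - t v + (y - b) = y - t v`. Since `X ≥ s + δ` and
  -- eventually `t ≤ s`, a correction of size at most `δ` keeps it nonnegative.
  c y j = fromℚ (X j) ℝ.+ fromℚ (- 1ℚ) ℝ.* t ℝ.+ sumℝ (λ l → fromℤ (B l j) ℝ.* (y l ℝ.+ fromℚ (- ι (b l))))
  seq-c : ∀ y j k → seq (c y j) k ≡ X j + - 1ℚ * seq t k + sumℚ (λ l → ι (B l j) * d y l k)
  seq-c y j k = cong (λ p → X j + - 1ℚ * seq t k + p) (seq-sum (λ l → fromℤ (B l j) ℝ.* (y l ℝ.+ fromℚ (- ι (b l)))) k)
  Near : Vector ℝ m → Set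
  Near y = ∀ i → fromℤ (b i) ℝ.< y i ℝ.+ fromℚ ε × y i ℝ.< fromℤ (b i) ℝ.+ fromℚ ε
  close₁ : ∀ y l → fromℤ (b l) ℝ.< y l ℝ.+ fromℚ ε → y l ℝ.< fromℤ (b l) ℝ.+ fromℚ ε → Eventually λ k → ℚ.∣ d y l k ∣ ≤ ε
  close₁ y l (mk< g 0<g g<) (mk< h 0<h h<) = eventually-map
    (λ k (g<k , h<k) → ∣p∣≤ (by-≤ (0≤-+ (ℚ.<⇒≤ (<-gap h<k)) (ℚ.<⇒≤ 0<h)) (upper (ι (b l)) (seq (y l) k) ε h))
                            (by-≤ (0≤-+ (ℚ.<⇒≤ (<-gap g<k)) (ℚ.<⇒≤ 0<g)) (lower (ι (b l)) (seq (y l) k) ε g)))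
    (eventually-zip g< h<)
    where
    upper : ∀ b y ε h → ε ≡ y + - b + (b + ε - (y + h) + h)
    upper = solve 4 (λ b y ε h → ε := y :+ :- b :+ (b :+ ε :- (y :+ h) :+ h)) refl
    lower : ∀ b y ε g → ε ≡ - (y + - b) + (y + ε - (b + g) + g)
    lower = solve 4 (λ b y ε g → ε := :- (y :+ :- b) :+ (y :+ ε :- (b :+ g) :+ g)) refl
  0≤c : ∀ y → Near y → ∀ j → 0ℝ ℝ.≤ c y j
  0≤c y near j = mk≤ λ η 0<η → eventually-map
    (λ k (t≤s , d≤ε) → by-< (0<-+ 0<η (0≤-+ (≤-gap (s+δ≤X j)) (0≤-+ (≤-gap t≤s)
        (≤-gap (ℚ.≤-trans (-p≤∣p∣ (sumℚ (λ l → ι (B l j) * d y l k))) (proj₂ (proj₂ continuity) (λ l → d y l k) d≤ε j))))))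
      (trans (cong (_+ η) (seq-c y j k)) (identity (X j) (seq t k) s δ η (sumℚ (λ l → ι (B l j) * d y l k)))))
    (eventually-zip t≤s (eventually-all λ l → close₁ y l (proj₁ (near l)) (proj₂ (near l))))
    where
    identity : ∀ x t s δ η u → x + - 1ℚ * t + u + η ≡ 0ℚ + (η + (x - (s + δ) + (s - t + (δ - - u))))
    identity = solve 6 (λ x t s δ η u → x :+ (:- con 1ℚ) :* t :+ u :+ η := con 0ℚ :+ (η :+ (x :- (s :+ δ) :+ (s :- t :+ (δ :- :- u))))) refl
  AB : ∀ y i k → (A ·ℚ (λ j → sumℚ (λ l → ι (B l j) * d y l k))) i ≡ d y i k
  AB y i k = begin
    (A ·ℚ (λ j → sumℚ (λ l → ι (B l j) * d y l k))) i
      ≡⟨ Σℚ.sum-product-assoc (λ j → ι (A i j)) (λ j l → ι (B l j)) (λ l → d y l k) ⟩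
    sumℚ (λ l → (A ·ℚ (ι ∘ B l)) i * d y l k)
      ≡⟨ Σℚ.sum-cong-≗ (λ l → cong (_* d y l k) (trans (·ℚ-ι A (B l) i) (cong ι (AB≡1 l i)))) ⟩
    sumℚ (λ l → ι (unit l i) * d y l k)
      ≡⟨ Σℚ.sum-single (λ l → ι (unit l i) * d y l k) i
           (λ l l≢i → trans (cong (λ u → ι u * d y l k) (unit-off-diagonal l≢i)) (ℚ.*-zeroˡ (d y l k))) ⟩
    ι (unit i i) * d y i k
      ≡⟨ cong (λ u → ι u * d y i k) (unit-diagonal i) ⟩
    1ℚ * d y i k
      ≡⟨ ℚ.*-identityˡ (d y i k) ⟩
    d y i k ∎
    where open ≡-Reasoning
  y≡ : ∀ y i k → seq (y i) k ≡ seq t k * columnSum A i + seq (sumℝ (λ j → c y j ℝ.* fromℤ (A i j))) k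
  y≡ y i k = sym (begin
    seq t k * columnSum A i + seq (sumℝ (λ j → c y j ℝ.* fromℤ (A i j))) k
      ≡⟨ cong T+ (trans (seq-sum (λ j → c y j ℝ.* fromℤ (A i j)) k) (Σℚ.sum-cong-≗ λ j → ℚ.*-comm (seq (c y j) k) (ι (A i j)))) ⟩
    T+ ((A ·ℚ (λ j → seq (c y j) k)) i)
      ≡⟨ cong T+ (·ℚ-cong A (λ j → trans (seq-c y j k) (cong (λ p → X j + p + u j) (move (seq t k)))) i) ⟩
    T+ ((A ·ℚ (λ j → X j + - seq t k * ι 1ℤ + u j)) i)
      ≡⟨ cong T+ (trans (·ℚ-+ A (λ j → X j + - seq t k * ι 1ℤ) u i) (cong₂ _+_ (·ℚ-+ A X (λ j → - seq t k * ι 1ℤ) i) (AB y i k))) ⟩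
    T+ ((A ·ℚ X) i + (A ·ℚ (λ j → - seq t k * ι 1ℤ)) i + d y i k)
      ≡⟨ cong₂ (λ p q → T+ (p + q + d y i k)) (AX≡b i)
           (trans (·ℚ-scale A (- seq t k) (λ _ → ι 1ℤ) i) (cong (- seq t k *_) (·ℚ-ι A (replicate _ 1ℤ) i))) ⟩
    T+ (ι (b i) + - seq t k * columnSum A i + d y i k)
      ≡⟨ identity (seq t k) (columnSum A i) (ι (b i)) (seq (y i) k) ⟩
    seq (y i) k ∎)
    where
    open ≡-Reasoning
    T+ : ℚ → ℚ
    T+ p = seq t k * columnSum A i + p
    u : Vector ℚ n
    u j = sumℚ (λ l → ι (B l j) * d y l k)
    move : ∀ t → - 1ℚ * t ≡ - t * 1ℚ
    move = solve 1 (λ t → (:- con 1ℚ) :* t := :- t :* con 1ℚ) refl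
    identity : ∀ t v b y → t * v + (b + - t * v + (y + - b)) ≡ y
    identity = solve 4 (λ t v b y → t :* v :+ (b :+ :- t :* v :+ (y :+ :- b)) := y) refl

-- The single tolerance 1 suffices, because an integer above -1 is nonnegative.
fromℤ-nonNeg⁻¹ : ∀ {i} → 0ℝ ℝ.≤ fromℤ i → 0ℤ ℤ.≤ i
fromℤ-nonNeg⁻¹ {i} (mk≤ below) =
  let N , 0<i+1 = below 1ℚ (ℚ.positive⁻¹ 1ℚ) in
  ℤ.i<j⇒suc[i]≤j {ℤ.- 1ℤ} (ι-cancel-< {ℤ.- 1ℤ} (by-< (<-gap (0<i+1 N ℕ.≤-refl)) (identity (ι i))))
  where
  identity : ∀ p → p ≡ - 1ℚ + (p + 1ℚ - 0ℚ)
  identity = solve 1 (λ p → p := :- con 1ℚ :+ (p :+ con 1ℚ :- con 0ℚ)) refl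

maxPositive-bound : {z : Vector ℤ n} {z⁺ : ℕ} → IsMaxPositive z z⁺ → ∀ j → z j ℤ.≤ + z⁺
maxPositive-bound {z = z} {z⁺} (_ , maximal) j = go (z j) refl
  where
  go : ∀ i → z j ≡ i → i ℤ.≤ + z⁺
  go (+ zero)  eq = ℤ.+≤+ ℕ.z≤n
  go (+ suc k) eq = ℤ.+≤+ (maximal (suc k) (j , subst (0ℤ ℤ.<_) (sym eq) (ℤ.+<+ (ℕ.s≤s ℕ.z≤n)) , eq))
  go -[1+ k ]  eq = ℤ.-≤+

maxAbsNegative-bound : {z : Vector ℤ n} {z⁻ : ℕ} → IsMaxAbsNegative z z⁻ → ∀ j → ℤ.- (+ z⁻) ℤ.≤ z j
maxAbsNegative-bound {z = z} {z⁻} (_ , maximal) j = go (z j) refl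
  where
  go : ∀ i → z j ≡ i → ℤ.- (+ z⁻) ℤ.≤ i
  go (+ k)    eq = ℤ.≤-trans (ℤ.neg-≤-pos {z⁻} {0}) (ℤ.+≤+ ℕ.z≤n)
  go -[1+ k ] eq = ℤ.neg-mono-≤ (ℤ.+≤+ (maximal (suc k) (j , subst (ℤ._< 0ℤ) (sym eq) ℤ.-<+ , cong ℤ.∣_∣ eq)))

maxPositive-nonZero : {z : Vector ℤ n} {z⁺ k : ℕ} → IsMaxPositive z z⁺ → NonZero (z⁺ ℕ.+ k)
maxPositive-nonZero {z⁺ = zero}  ((i , 0<zi , zi≡0) , _) = contradiction (subst (0ℤ ℤ.<_) zi≡0 0<zi) (ℤ.<-irrefl refl)
maxPositive-nonZero {z⁺ = suc _} _                       = _

maxPositive : (z : Vector ℤ n) → ∃[ i ] 0ℤ ℤ.< z i → ∃[ z⁺ ] IsMaxPositive z z⁺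
maxPositive z ∃pos with i , 0<zi , maximal ← argmax (λ i → ℤ.∣ z i ∣) (λ i → 0ℤ ℤ.<? z i) ∃pos
  = ℤ.∣ z i ∣ , (i , 0<zi , sym (ℤ.0≤i⇒+∣i∣≡i (ℤ.<⇒≤ 0<zi))) ,
    λ k (j , 0<zj , zj≡k) → subst (ℕ._≤ ℤ.∣ z i ∣) (cong ℤ.∣_∣ zj≡k) (maximal j 0<zj)

maxAbsNegative : (z : Vector ℤ n) → ∃[ i ] z i ℤ.< 0ℤ → ∃[ z⁻ ] IsMaxAbsNegative z z⁻
maxAbsNegative z ∃neg with i , zi<0 , maximal ← argmax (λ i → ℤ.∣ z i ∣) (λ i → z i ℤ.<? 0ℤ) ∃neg
  = ℤ.∣ z i ∣ , (i , zi<0 , refl) , λ k (j , zj<0 , ∣zj∣≡k) → subst (ℕ._≤ ℤ.∣ z i ∣) ∣zj∣≡k (maximal j zj<0)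

negative≡-∣∣ : ∀ {i k} → i ℤ.< 0ℤ → ℤ.∣ i ∣ ≡ k → i ≡ ℤ.- (+ k)
negative≡-∣∣ {+ _}      (ℤ.+<+ ())
negative≡-∣∣ { -[1+ _ ]} _ refl = refl

·ℤ-+ : (A : Matrix m n) (x y : Vector ℤ n) (i : Fin m) → (A ·ℤ (λ j → x j ℤ.+ y j)) i ≡ (A ·ℤ x) i ℤ.+ (A ·ℤ y) i
·ℤ-+ A x y i = trans (Σℤ.sum-cong-≗ λ j → ℤ.*-distribˡ-+ (A i j) (x j) (y j))
                     (Σℤ.∑-distrib-+ (λ j → A i j ℤ.* x j) (λ j → A i j ℤ.* y j))

-- Admissibility and minimality of the Frobenius value

module _ (A : Matrix m n) (minors-gcd : IsGCD (maximalMinor A) 1ℤ)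
         (z : Vector ℤ n) (generator : IsPrimitiveKernelGenerator A z)
         (z⁺ z⁻ : ℕ) .{{nz : NonZero (z⁺ ℕ.+ z⁻)}}
         (max⁺ : IsMaxPositive z z⁺) (max⁻ : IsMaxAbsNegative z z⁻) where

  open Frobenius z⁺ z⁻

  -- Rational `s` suffice, since the two minima to be exhibited, the value and its maximum with 0,
  -- are rational.
  admissible : (s : ℚ) → frobeniusValue z⁺ z⁻ ≤ s → Admissible A (fromℚ s)
  admissible s value≤s b int =
    let x , Ax≡b = ·ℤ-surjective A minors-gcd b
        r , above = interior⇒above A z generator b x Ax≡b s int
        k , feasible = integral-point z (maxPositive-bound max⁺) (maxAbsNegative-bound max⁻) value≤s x r above
    in (λ _ j → x j ℤ.+ k ℤ.* z j) ,
       (λ _ → (λ j → fromℤ-nonNeg {x j ℤ.+ k ℤ.* z j} (feasible j)) , ·-fromℤ A {λ j → x j ℤ.+ k ℤ.* z j} {b} λ i →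
          trans (·ℤ-+ A x (λ j → k ℤ.* z j) i)
                (trans (cong₂ ℤ._+_ (Ax≡b i) (multiple-kernel A z generator k i)) (ℤ.+-identityʳ (b i)))) ,
       λ { zero zero 0≢0 → contradiction refl 0≢0 }

  x₀ : Vector ℤ n
  x₀ = extremal z (maxPositive-bound max⁺) (maxAbsNegative-bound max⁻)

  -- A nonnegative integral solution would differ from `x₀` by a kernel vector, hence be some
  -- `x₀ + k z`, against `extremal-infeasible`.
  x₀-not-representable : ¬ 𝓕 1 A (A ·ℤ x₀)
  x₀-not-representable (f , feasible , _) =
    extremal-infeasible z (maxPositive-bound max⁺) (maxAbsNegative-bound max⁻)
      (proj₁ (proj₁ max⁺)) (proj₁ (proj₁ max⁻)) (proj₁ (proj₂ (proj₁ max⁺))) (proj₂ (proj₂ (proj₁ max⁺)))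
      (proj₁ (proj₂ (proj₁ max⁻))) (negative≡-∣∣ (proj₁ (proj₂ (proj₁ max⁻))) (proj₂ (proj₂ (proj₁ max⁻))))
      (proj₁ multiple) λ j → subst (0ℤ ℤ.≤_) (trans (restore (x₀ j) (x j)) (cong (λ y → x₀ j ℤ.+ y) (proj₂ multiple j)))
                                   (fromℤ-nonNeg⁻¹ {x j} (proj₁ (feasible zero) j))
    where
    x : Vector ℤ n
    x = f zero
    restore : ∀ y x → x ≡ y ℤ.+ (1ℤ ℤ.* x ℤ.+ ℤ.- 1ℤ ℤ.* y)
    restore = solve-∀
    cancel : ∀ y → 1ℤ ℤ.* y ℤ.+ ℤ.- 1ℤ ℤ.* y ≡ 0ℤ
    cancel = solve-∀
    multiple : ∃[ k ] (∀ j → 1ℤ ℤ.* x j ℤ.+ ℤ.- 1ℤ ℤ.* x₀ j ≡ k ℤ.* z j)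
    multiple = kernel-multiple A z generator (λ j → 1ℤ ℤ.* x j ℤ.+ ℤ.- 1ℤ ℤ.* x₀ j) λ i →
      trans (·ℤ-combination A 1ℤ (ℤ.- 1ℤ) x x₀ i)
            (trans (cong (λ y → 1ℤ ℤ.* y ℤ.+ ℤ.- 1ℤ ℤ.* (A ·ℤ x₀) i)
                         (fromℤ-· A {x} {A ·ℤ x₀} (proj₂ (feasible zero)) i))
                   (cancel ((A ·ℤ x₀) i)))

  inadmissible : (t : ℝ) (s δ : ℚ) → Eventually (λ k → seq t k ≤ s) → 0ℚ < δ → s + δ ≤ frobeniusValue z⁺ z⁻ → ¬ Admissible A t
  inadmissible t s δ t≤s 0<δ s+δ≤value adm = x₀-not-representable (adm (A ·ℤ x₀)
    (above⇒interior A (λ l → proj₁ (·ℤ-surjective A minors-gcd (unit l))) (λ l → proj₂ (·ℤ-surjective A minors-gcd (unit l)))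
      t s δ t≤s 0<δ (A ·ℤ x₀) X AX≡ λ j → ℚ.≤-trans s+δ≤value (value≤extremal z (maxPositive-bound max⁺) (maxAbsNegative-bound max⁻) j)))
    where
    X : Vector ℚ n
    -- The real solution over the same right-hand side at `r = b * κ`, where every entry reaches the
    -- Frobenius value.
    X j = ι (x₀ j) + b * κ * ι (z j)
    Az≡0 : ∀ i → (A ·ℚ (ι ∘ z)) i ≡ 0ℚ
    Az≡0 i = trans (·ℚ-cong A (λ j → cong ι (sym (ℤ.*-identityˡ (z j)))) i)
                   (trans (·ℚ-ι A (λ j → 1ℤ ℤ.* z j) i) (cong ι (multiple-kernel A z generator 1ℤ i)))
    AX≡ : ∀ i → (A ·ℚ X) i ≡ ι ((A ·ℤ x₀) i)
    AX≡ i = trans (·ℚ-+ A (ι ∘ x₀) (λ j → b * κ * ι (z j)) i)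
      (trans (cong₂ _+_ (·ℚ-ι A x₀ i) (trans (·ℚ-scale A (b * κ) (ι ∘ z) i) (trans (cong (b * κ *_) (Az≡0 i)) (ℚ.*-zeroʳ (b * κ)))))
             (ℚ.+-identityʳ (ι ((A ·ℤ x₀) i))))

  -- From some `N` on, `t` varies by less than `ε / 4`, and the rational comparison of the value
  -- with `t` at `N` plus `ε / 2` is decidable. If the value is smaller, the variation still leaves
  -- it below `t + ε`. Otherwise `t` is eventually at most its term at `N` plus `ε / 4`, which
  -- leaves `δ = ε / 4` up to the value and makes `t` inadmissible.
  value-minimal : (t : ℝ) → Admissible A t → fromℚ (frobeniusValue z⁺ z⁻) ℝ.≤ t
  value-minimal t adm = mk≤ λ ε 0<ε → go ε 0<ε (cauchy t (½ * (½ * ε)) (half-pos (½ * ε) (half-pos ε 0<ε)))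
    where
    go : ∀ ε → 0ℚ < ε → ∃[ N ] (∀ k l → N ℕ.≤ k → N ℕ.≤ l → ℚ.∣ seq t k - seq t l ∣ < ½ * (½ * ε)) →
         Eventually λ k → frobeniusValue z⁺ z⁻ < seq t k + ε
    go ε 0<ε (N , near) = decide (frobeniusValue z⁺ z⁻ ℚ.<? seq t N + ½ * ε)
      where
      η : ℚ
      η = ½ * (½ * ε)
      0<η : 0ℚ < η
      0<η = half-pos (½ * ε) (half-pos ε 0<ε)
      above : ∀ v tN tk ε → tk + ε ≡ v + (tN + ½ * ε - v + (½ * (½ * ε) - (tN - tk) + ½ * (½ * ε)))
      above = solve 4 (λ v tN tk ε → tk :+ ε :=
        v :+ (tN :+ con ½ :* ε :- v :+ (con ½ :* (con ½ :* ε) :- (tN :- tk) :+ con ½ :* (con ½ :* ε)))) refl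
      below : ∀ tN tk η → tN + η ≡ tk + (η - (tk - tN))
      below = solve 3 (λ tN tk η → tN :+ η := tk :+ (η :- (tk :- tN))) refl
      room : ∀ tN ε → tN + ½ * (½ * ε) + ½ * (½ * ε) ≡ tN + ½ * ε
      room = solve 2 (λ tN ε → tN :+ con ½ :* (con ½ :* ε) :+ con ½ :* (con ½ :* ε) := tN :+ con ½ :* ε) refl
      decide : Dec (frobeniusValue z⁺ z⁻ < seq t N + ½ * ε) → Eventually λ k → frobeniusValue z⁺ z⁻ < seq t k + ε
      decide (yes v<) = N , λ k N≤k → by-<
        (0<-+ (<-gap v<) (0≤-+ (ℚ.<⇒≤ (<-gap (ℚ.≤-<-trans (p≤∣p∣ (seq t N - seq t k)) (near N k ℕ.≤-refl N≤k)))) (ℚ.<⇒≤ 0<η)))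
        (above (frobeniusValue z⁺ z⁻) (seq t N) (seq t k) ε)
      decide (no  v≮) = contradiction adm (inadmissible t (seq t N + η) η
        (N , λ k N≤k → by-≤ (ℚ.<⇒≤ (<-gap (ℚ.≤-<-trans (p≤∣p∣ (seq t k - seq t N)) (near k N N≤k ℕ.≤-refl)))) (below (seq t N) (seq t k) η))
        0<η (ℚ.≤-trans (ℚ.≤-reflexive (room (seq t N) ε)) (ℚ.≮⇒≥ v≮)))

  signed-frobenius : IsSignedDiagonalFrobenius A (fromℚ (frobeniusValue z⁺ z⁻ {{nz}}))
  signed-frobenius = admissible (frobeniusValue z⁺ z⁻ {{nz}}) ℚ.≤-refl , value-minimal

  -- Every rational from the value upwards is admissible, so the constraint `t ≥ 0` merely cuts off
  -- at 0; the lower bound is one of the two hypotheses on `t`, according to which argument the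
  -- maximum equals.
  frobenius : IsDiagonalFrobenius A (fromℚ (0ℚ ℚ.⊔ frobeniusValue z⁺ z⁻ {{nz}}))
  frobenius =
    (mk≤ (λ ε 0<ε → 0 , λ _ _ → by-< (0<-+ 0<ε (ℚ.p≤p⊔q 0ℚ (frobeniusValue z⁺ z⁻ {{nz}})))
       (trans (ℚ.+-comm (0ℚ ℚ.⊔ frobeniusValue z⁺ z⁻ {{nz}}) ε) (sym (ℚ.+-identityˡ _)))) ,
     admissible (0ℚ ℚ.⊔ frobeniusValue z⁺ z⁻ {{nz}}) (ℚ.p≤q⊔p 0ℚ (frobeniusValue z⁺ z⁻ {{nz}}))) ,
    λ t (0≤t , adm) → [ (λ eq → subst (λ p → fromℚ p ℝ.≤ t) (sym eq) 0≤t) ,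
                        (λ eq → subst (λ p → fromℚ p ℝ.≤ t) (sym eq) (value-minimal t adm)) ]′ (ℚ.⊔-sel 0ℚ (frobeniusValue z⁺ z⁻ {{nz}}))

theorem1p4 : (n m : ℕ) → 2 ℕ.≤ n → m ≡ n ∸ 1 →
    (A : Matrix m n) →
    IsGCD (maximalMinor A) 1ℤ →
    (∀ x → P A (replicate m 0ℤ) x ⇔ x ≈ⱽ replicate n 0ℝ) →
    (z : Vector ℤ n) → IsPrimitiveKernelGenerator A z →
    ∃[ z⁺ ] ∃[ z⁻ ] (IsMaxPositive z z⁺ × IsMaxAbsNegative z z⁻ ×
    (Σ[ nz ∈ NonZero (z⁺ ℕ.+ z⁻) ]
    (IsSignedDiagonalFrobenius A (fromℚ (frobeniusValue z⁺ z⁻ {{nz}})) ×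
    IsDiagonalFrobenius A (fromℚ (0ℚ ℚ.⊔ frobeniusValue z⁺ z⁻ {{nz}})))))
theorem1p4 n m _ _ A minors-gcd pointed z generator =
  conclude (maxPositive z positive-entry) (maxAbsNegative z some-negative)
  where
  positive-entry : ∃[ i ] 0ℤ ℤ.< z i
  positive-entry = let i , -zi<0 = negative-entry A pointed z generator (ℤ.- 1ℤ) in
    i , ℤ.neg-cancel-< (subst (ℤ._< 0ℤ) (ℤ.-1*i≡-i (z i)) -zi<0)
  some-negative : ∃[ i ] z i ℤ.< 0ℤ
  some-negative = let i , zi<0 = negative-entry A pointed z generator 1ℤ in
    i , subst (ℤ._< 0ℤ) (ℤ.*-identityˡ (z i)) zi<0
  conclude : ∃[ z⁺ ] IsMaxPositive z z⁺ → ∃[ z⁻ ] IsMaxAbsNegative z z⁻ →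
    ∃[ z⁺ ] ∃[ z⁻ ] (IsMaxPositive z z⁺ × IsMaxAbsNegative z z⁻ ×
    (Σ[ nz ∈ NonZero (z⁺ ℕ.+ z⁻) ]
    (IsSignedDiagonalFrobenius A (fromℚ (frobeniusValue z⁺ z⁻ {{nz}})) ×
    IsDiagonalFrobenius A (fromℚ (0ℚ ℚ.⊔ frobeniusValue z⁺ z⁻ {{nz}})))))
  conclude (z⁺ , max⁺) (z⁻ , max⁻) = z⁺ , z⁻ , max⁺ , max⁻ , nz ,
    signed-frobenius A minors-gcd z generator z⁺ z⁻ {{nz}} max⁺ max⁻ ,
    frobenius A minors-gcd z generator z⁺ z⁻ {{nz}} max⁺ max⁻
    where
    nz : NonZero (z⁺ ℕ.+ z⁻)
    nz = maxPositive-nonZero {z = z} max⁺
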